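{- Let $0<c_1\le c_2<1$ be real values such that $c_1>c_1^*(c_2)$. Then there exists an $n_0 = O\left(\mathrm{poly}\left(\frac{1}{c_1-c_1^*(c_2)}\right)\right)$ such that for any $n\ge n_0$, any degree sequence $D$ of length $n$ with degrees between $c_1\binom{n-1}{2}$ and $c_2\binom{n-1}{2}$ has a $3$-uniform hypergraph realization if and only if the sum of its degrees can be divided by $3$. In particular, any degree sequence $D$ of length $n\ge n_0$ in $\mathcal{D}_{c_1,c_2}$ is graphic.
   Context: A hypergraph $H=(V,E)$ is $3$-uniform if $E\subseteq \binom{V}{3}$; the degree $d(v)$ of a vertex is the number of hyperedges containing it. A degree sequence is a finite sequence of non-negative integers. A $3$-uniform hypergraph on $v_1,\dots,v_n$ is a realization of $D=(d_1,\dots,d_n)$ if $d(v_i)=d_i$ for all $i$; $D$ is graphic if it has a $3$-uniform hypergraph realization. For $c_1,c_2>0$, $\mathcal{D}_{c_1,c_2}$ is the class of degree sequences such that each $D=(d_1,\dots,d_n)\in\mathcal{D}_{c_1,c_2}$ of length $n$ satisfies $\sum_i d_i\equiv 0\pmod 3$ and $c_1\binom{n-1}{2}\le d_i\le c_2\binom{n-1}{2}$ for all $i$. For $c_2\in(0,1)$, $c_1^*(c_2):=\max_{\alpha\in(0,1)} C\left(\alpha,\frac{c_2}{2}\right)$, where $$C(\alpha,d)=\begin{cases}0 & d\le \frac{\alpha^2}{2},\\ \frac{\alpha}{1-\alpha}\left(\frac{2d-\alpha^2}{2}\right) & \frac{\alpha^2}{2}<d\le \alpha\left(1-\frac{\alpha}{2}\right),\\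 \frac{2\alpha}{1-\alpha}(2d-\alpha^2)-3\alpha^2 & d>\alpha\left(1-\frac{\alpha}{2}\right).\end{cases}$$ $\mathrm{poly}$ denotes some polynomial. -}

module Defs where

open import Data.Fin using (Fin)
open import Data.Fin.Subset using (Subset; ∣_∣)
open import Data.Fin.Subset.Properties using (_∈?_)
open import Data.List using (List; []; _∷_; length; filter)
open import Data.List.Relation.Unary.All using (All)
open import Data.List.Relation.Unary.Unique.Propositional using (Unique)
open import Data.Nat as ℕ using (ℕ)
open import Data.Nat.Combinatorics using (_C_)
open import Data.Nat.Divisibility using (_∣_)
import Data.Nat.Properties as ℕₚ
open import Data.Integer using (+_)
open import Data.Product using (_×_; _,_; Σ-syntax; ∃-syntax)
open import Data.Rational as ℚ using (ℚ; 0ℚ; 1ℚ; ½)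
import Data.Rational.Properties as ℚₚ
open import Data.Rational.Solver using (module +-*-Solver)
open import Data.Vec using (Vec; lookup; sum)
open import Relation.Binary.PropositionalEquality
  using (_≡_; refl; sym; trans; cong; cong₂; subst)
open import Relation.Nullary using (¬_; yes; no; contradiction)

Cauchy : (ℕ → ℚ) → Set
Cauchy x = ∀ ε → 0ℚ ℚ.< ε →
  ∃[ N ] ∀ m n → N ℕ.≤ m → N ℕ.≤ n → ℚ.∣ x m ℚ.- x n ∣ ℚ.< ε

record ℝ : Set where
  field
    seq    : ℕ → ℚ
    cauchy : Cauchy seq

open ℝ public

infix  4 _≃_ _<_ _≤_
infixl 6 _+_ _-_
infixl 7 _*_
infix  8 -_

_≃_ _<_ _≤_ : ℝ → ℝ → Set
x ≃ y = ∀ ε → 0ℚ ℚ.< ε → ∃[ N ] ∀ n → N ℕ.≤ n → ℚ.∣ seq x n ℚ.- seq y n ∣ ℚ.< ε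
x < y = ∃[ ε ] 0ℚ ℚ.< ε × ∃[ N ] ∀ n → N ℕ.≤ n → seq x n ℚ.+ ε ℚ.≤ seq y n
x ≤ y = ¬ (y < x)

fromℚ : ℚ → ℝ
seq    (fromℚ q) _ = q
cauchy (fromℚ q) ε 0<ε = 0 , λ _ _ _ _ →
  subst (λ r → ℚ.∣ r ∣ ℚ.< ε) (sym (ℚₚ.+-inverseʳ q)) 0<ε

fromℕ : ℕ → ℝ
fromℕ n = fromℚ (+ n ℚ./ 1)

0ℝ 1ℝ 2ℝ 3ℝ ½ℝ : ℝ
0ℝ = fromℚ 0ℚ
1ℝ = fromℚ 1ℚ
2ℝ = fromℕ 2
3ℝ = fromℕ 3
½ℝ = fromℚ ½

private
  half-pos : ∀ {ε} → 0ℚ ℚ.< ε → 0ℚ ℚ.< ½ ℚ.* ε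
  half-pos {ε} p = subst (ℚ._< ½ ℚ.* ε) (ℚₚ.*-zeroʳ ½) (ℚₚ.*-monoʳ-<-pos ½ p)

  halves : ∀ ε → ½ ℚ.* ε ℚ.+ ½ ℚ.* ε ≡ ε
  halves ε = trans (sym (ℚₚ.*-distribʳ-+ ε ½ ½)) (ℚₚ.*-identityˡ ε)

  mul-pos : ∀ {p q} → 0ℚ ℚ.< p → 0ℚ ℚ.< q → 0ℚ ℚ.< p ℚ.* q
  mul-pos {p} {q} 0<p 0<q = subst (ℚ._< p ℚ.* q) (ℚₚ.*-zeroʳ p)
    (ℚₚ.*-monoʳ-<-pos p {{ℚ.positive 0<p}} 0<q)

  nonNeg-+-pos : ∀ {p q} → 0ℚ ℚ.≤ p → 0ℚ ℚ.< q → 0ℚ ℚ.< p ℚ.+ q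
  nonNeg-+-pos {p} {q} 0≤p 0<q =
    subst (ℚ._< p ℚ.+ q) (ℚₚ.+-identityˡ 0ℚ) (ℚₚ.+-mono-≤-< 0≤p 0<q)

  mul-mono-≤ : ∀ {p q r s} → 0ℚ ℚ.≤ p → 0ℚ ℚ.≤ s → p ℚ.≤ q → r ℚ.≤ s →
    p ℚ.* r ℚ.≤ q ℚ.* s
  mul-mono-≤ {p} {q} {r} {s} 0≤p 0≤s p≤q r≤s = ℚₚ.≤-trans
    (ℚₚ.*-monoˡ-≤-nonNeg p {{ℚ.nonNegative 0≤p}} r≤s)
    (ℚₚ.*-monoʳ-≤-nonNeg s {{ℚ.nonNegative 0≤s}} p≤q)

  open +-*-Solver

  +-rearrange : ∀ a b c d →
    (a ℚ.+ b) ℚ.- (c ℚ.+ d) ≡ (a ℚ.- c) ℚ.+ (b ℚ.- d)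
  +-rearrange = solve 4 (λ a b c d →
    (a :+ b) :- (c :+ d) := (a :- c) :+ (b :- d)) refl

  *-rearrange : ∀ a b c d →
    (a ℚ.* b) ℚ.- (c ℚ.* d) ≡ a ℚ.* (b ℚ.- d) ℚ.+ d ℚ.* (a ℚ.- c)
  *-rearrange = solve 4 (λ a b c d →
    (a :* b) :- (c :* d) := a :* (b :- d) :+ d :* (a :- c)) refl

  neg-rearrange : ∀ a b → (ℚ.- a) ℚ.- (ℚ.- b) ≡ ℚ.- (a ℚ.- b)
  neg-rearrange = solve 2 (λ a b → (:- a) :- (:- b) := :- (a :- b)) refl

  split : ∀ a b → a ≡ b ℚ.+ (a ℚ.- b)
  split = solve 2 (λ a b → a := b :+ (a :- b)) refl

  Bounded : (ℕ → ℚ) → Set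
  Bounded x = ∃[ A ] 0ℚ ℚ.< A × ∃[ N ] ∀ n → N ℕ.≤ n → ℚ.∣ x n ∣ ℚ.≤ A

  bounded : ∀ x → Cauchy x → Bounded x
  bounded x cx with cx 1ℚ (ℚₚ.positive⁻¹ 1ℚ)
  ... | N , h = ℚ.∣ x N ∣ ℚ.+ 1ℚ
      , nonNeg-+-pos (ℚₚ.0≤∣p∣ (x N)) (ℚₚ.positive⁻¹ 1ℚ)
      , N , λ n N≤n → ℚₚ.≤-trans
          (ℚₚ.≤-reflexive (cong ℚ.∣_∣ (split (x n) (x N))))
          (ℚₚ.≤-trans (ℚₚ.∣p+q∣≤∣p∣+∣q∣ (x N) (x n ℚ.- x N))
            (ℚₚ.+-monoʳ-≤ ℚ.∣ x N ∣ (ℚₚ.<⇒≤ (h n N N≤n ℕₚ.≤-refl))))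

private
  +-cauchy : ∀ x y → Cauchy x → Cauchy y → Cauchy (λ n → x n ℚ.+ y n)
  +-cauchy x y cx cy ε 0<ε with cx (½ ℚ.* ε) (half-pos 0<ε) | cy (½ ℚ.* ε) (half-pos 0<ε)
  ... | M , hx | N , hy = M ℕ.⊔ N , λ m n p q → begin-strict
    ℚ.∣ (x m ℚ.+ y m) ℚ.- (x n ℚ.+ y n) ∣
      ≡⟨ cong ℚ.∣_∣ (+-rearrange (x m) (y m) (x n) (y n)) ⟩
    ℚ.∣ (x m ℚ.- x n) ℚ.+ (y m ℚ.- y n) ∣
      ≤⟨ ℚₚ.∣p+q∣≤∣p∣+∣q∣ (x m ℚ.- x n) (y m ℚ.- y n) ⟩
    ℚ.∣ x m ℚ.- x n ∣ ℚ.+ ℚ.∣ y m ℚ.- y n ∣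
      <⟨ ℚₚ.+-mono-< (hx m n (ℕₚ.m⊔n≤o⇒m≤o M N p) (ℕₚ.m⊔n≤o⇒m≤o M N q))
                     (hy m n (ℕₚ.m⊔n≤o⇒n≤o M N p) (ℕₚ.m⊔n≤o⇒n≤o M N q)) ⟩
    ½ ℚ.* ε ℚ.+ ½ ℚ.* ε
      ≡⟨ halves ε ⟩
    ε ∎
    where open ℚₚ.≤-Reasoning

  neg-cauchy : ∀ x → Cauchy x → Cauchy (λ n → ℚ.- x n)
  neg-cauchy x cx ε 0<ε = let (N , h) = cx ε 0<ε in
    N , λ m n p q → subst (ℚ._< ε)
      (sym (trans (cong ℚ.∣_∣ (neg-rearrange (x m) (x n)))
                  (ℚₚ.∣-p∣≡∣p∣ (x m ℚ.- x n))))
      (h m n p q)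

_+_ : ℝ → ℝ → ℝ
seq    (x + y) n = seq x n ℚ.+ seq y n
cauchy (x + y)   = +-cauchy (seq x) (seq y) (cauchy x) (cauchy y)

-_ : ℝ → ℝ
seq    (- x) n = ℚ.- seq x n
cauchy (- x)   = neg-cauchy (seq x) (cauchy x)

_-_ : ℝ → ℝ → ℝ
x - y = x + (- y)

private
  divide : ∀ {A ε} → 0ℚ ℚ.< A → 0ℚ ℚ.< ε → ∃[ δ ] 0ℚ ℚ.< δ × A ℚ.* δ ≡ ε
  divide {A} {ε} 0<A 0<ε =
    i ℚ.* ε
    , mul-pos (ℚₚ.positive⁻¹ i {{ℚₚ.1/pos⇒pos A {{ℚ.positive 0<A}}}}) 0<ε
    , trans (sym (ℚₚ.*-assoc A i ε))
        (trans (cong (ℚ._* ε) (ℚₚ.*-inverseʳ A {{A≢0}})) (ℚₚ.*-identityˡ ε))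
    where
    A≢0 : ℚ.NonZero A
    A≢0 = ℚₚ.pos⇒nonZero A {{ℚ.positive 0<A}}
    i : ℚ
    i = (ℚ.1/ A) {{A≢0}}

  ∣*∣-bound : ∀ {A δ} a b → 0ℚ ℚ.< A → ℚ.∣ a ∣ ℚ.≤ A → ℚ.∣ b ∣ ℚ.< δ →
    ℚ.∣ a ℚ.* b ∣ ℚ.< A ℚ.* δ
  ∣*∣-bound {A} {δ} a b 0<A a≤A b<δ = begin-strict
    ℚ.∣ a ℚ.* b ∣        ≡⟨ ℚₚ.∣p*q∣≡∣p∣*∣q∣ a b ⟩
    ℚ.∣ a ∣ ℚ.* ℚ.∣ b ∣  ≤⟨ ℚₚ.*-monoʳ-≤-nonNeg ℚ.∣ b ∣ {{ℚₚ.∣-∣-nonNeg b}} a≤A ⟩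
    A ℚ.* ℚ.∣ b ∣        <⟨ ℚₚ.*-monoʳ-<-pos A {{ℚ.positive 0<A}} b<δ ⟩
    A ℚ.* δ              ∎
    where open ℚₚ.≤-Reasoning

  product-bound : ∀ {A B δ} a b c d → 0ℚ ℚ.< A → 0ℚ ℚ.< B →
    ℚ.∣ a ∣ ℚ.≤ A → ℚ.∣ d ∣ ℚ.≤ B → ℚ.∣ b ℚ.- d ∣ ℚ.< δ → ℚ.∣ a ℚ.- c ∣ ℚ.< δ →
    ℚ.∣ a ℚ.* b ℚ.- c ℚ.* d ∣ ℚ.< (A ℚ.+ B) ℚ.* δ
  product-bound {A} {B} {δ} a b c d 0<A 0<B a≤A d≤B bd ac = begin-strict
    ℚ.∣ a ℚ.* b ℚ.- c ℚ.* d ∣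
      ≡⟨ cong ℚ.∣_∣ (*-rearrange a b c d) ⟩
    ℚ.∣ a ℚ.* (b ℚ.- d) ℚ.+ d ℚ.* (a ℚ.- c) ∣
      ≤⟨ ℚₚ.∣p+q∣≤∣p∣+∣q∣ (a ℚ.* (b ℚ.- d)) (d ℚ.* (a ℚ.- c)) ⟩
    ℚ.∣ a ℚ.* (b ℚ.- d) ∣ ℚ.+ ℚ.∣ d ℚ.* (a ℚ.- c) ∣
      <⟨ ℚₚ.+-mono-< (∣*∣-bound a (b ℚ.- d) 0<A a≤A bd)
                     (∣*∣-bound d (a ℚ.- c) 0<B d≤B ac) ⟩
    A ℚ.* δ ℚ.+ B ℚ.* δ
      ≡⟨ sym (ℚₚ.*-distribʳ-+ δ A B) ⟩
    (A ℚ.+ B) ℚ.* δ ∎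
    where open ℚₚ.≤-Reasoning

  *-cauchy : ∀ x y → Cauchy x → Cauchy y → Bounded x → Bounded y →
    Cauchy (λ n → x n ℚ.* y n)
  *-cauchy x y cx cy (A , 0<A , Nx , hA) (B , 0<B , Ny , hB) ε 0<ε =
    choose-δ (divide (nonNeg-+-pos (ℚₚ.<⇒≤ 0<A) 0<B) 0<ε)
    where
    Goal : Set
    Goal = ∃[ N ] ∀ m n → N ℕ.≤ m → N ℕ.≤ n →
      ℚ.∣ x m ℚ.* y m ℚ.- x n ℚ.* y n ∣ ℚ.< ε
    conclude : ∀ {δ} → (A ℚ.+ B) ℚ.* δ ≡ ε →
      (∃[ N ] ∀ m n → N ℕ.≤ m → N ℕ.≤ n → ℚ.∣ x m ℚ.- x n ∣ ℚ.< δ) →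
      (∃[ N ] ∀ m n → N ℕ.≤ m → N ℕ.≤ n → ℚ.∣ y m ℚ.- y n ∣ ℚ.< δ) → Goal
    conclude total (Mx , hx) (My , hy) =
      (Nx ℕ.⊔ Ny) ℕ.⊔ (Mx ℕ.⊔ My) , λ m n p q →
      let p₁ = ℕₚ.m⊔n≤o⇒m≤o (Nx ℕ.⊔ Ny) (Mx ℕ.⊔ My) p
          p₂ = ℕₚ.m⊔n≤o⇒n≤o (Nx ℕ.⊔ Ny) (Mx ℕ.⊔ My) p
          q₁ = ℕₚ.m⊔n≤o⇒m≤o (Nx ℕ.⊔ Ny) (Mx ℕ.⊔ My) q
          q₂ = ℕₚ.m⊔n≤o⇒n≤o (Nx ℕ.⊔ Ny) (Mx ℕ.⊔ My) q
      in subst (ℚ.∣ x m ℚ.* y m ℚ.- x n ℚ.* y n ∣ ℚ.<_) total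
        (product-bound (x m) (y m) (x n) (y n) 0<A 0<B
          (hA m (ℕₚ.m⊔n≤o⇒m≤o Nx Ny p₁)) (hB n (ℕₚ.m⊔n≤o⇒n≤o Nx Ny q₁))
          (hy m n (ℕₚ.m⊔n≤o⇒n≤o Mx My p₂) (ℕₚ.m⊔n≤o⇒n≤o Mx My q₂))
          (hx m n (ℕₚ.m⊔n≤o⇒m≤o Mx My p₂) (ℕₚ.m⊔n≤o⇒m≤o Mx My q₂)))
    choose-δ : (∃[ δ ] 0ℚ ℚ.< δ × (A ℚ.+ B) ℚ.* δ ≡ ε) → Goal
    choose-δ (δ , 0<δ , total) = conclude total (cx δ 0<δ) (cy δ 0<δ)

_*_ : ℝ → ℝ → ℝ
seq    (x * y) n = seq x n ℚ.* seq y n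
cauchy (x * y)   = *-cauchy (seq x) (seq y) (cauchy x) (cauchy y)
  (bounded (seq x) (cauchy x)) (bounded (seq y) (cauchy y))

-- The value at 0 is irrelevant: it only affects finitely many terms of the
-- reciprocal of a positive real.
invℚ : ℚ → ℚ
invℚ q with q ℚ.≟ 0ℚ
... | yes _  = 0ℚ
... | no q≢0 = ℚ.1/_ q {{ℚ.≢-nonZero q≢0}}

private
  invℚ-inverseʳ : ∀ {q} → 0ℚ ℚ.< q → q ℚ.* invℚ q ≡ 1ℚ
  invℚ-inverseʳ {q} 0<q with q ℚ.≟ 0ℚ
  ... | yes q≡0 = contradiction (sym q≡0) (ℚₚ.<⇒≢ 0<q)
  ... | no q≢0  = ℚₚ.*-inverseʳ q {{ℚ.≢-nonZero q≢0}}

  inv-rearrange : ∀ a b i j →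
    (a ℚ.* b) ℚ.* (i ℚ.- j) ≡ b ℚ.* (a ℚ.* i) ℚ.- a ℚ.* (b ℚ.* j)
  inv-rearrange = solve 4 (λ a b i j →
    (a :* b) :* (i :- j) := b :* (a :* i) :- a :* (b :* j)) refl

  inv-bound : ∀ {δ η} a b → 0ℚ ℚ.< δ → δ ℚ.≤ a → δ ℚ.≤ b →
    ℚ.∣ b ℚ.- a ∣ ℚ.< (δ ℚ.* δ) ℚ.* η → ℚ.∣ invℚ a ℚ.- invℚ b ∣ ℚ.< η
  inv-bound {δ} {η} a b 0<δ δ≤a δ≤b h = bound (invℚ a) (invℚ b)
    (invℚ-inverseʳ 0<a) (invℚ-inverseʳ 0<b)
    where
    0<a : 0ℚ ℚ.< a
    0<a = ℚₚ.<-≤-trans 0<δ δ≤a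
    0<b : 0ℚ ℚ.< b
    0<b = ℚₚ.<-≤-trans 0<δ δ≤b
    bound : ∀ i j → a ℚ.* i ≡ 1ℚ → b ℚ.* j ≡ 1ℚ → ℚ.∣ i ℚ.- j ∣ ℚ.< η
    bound i j ai≡1 bj≡1 = ℚₚ.*-cancelˡ-<-nonNeg (δ ℚ.* δ)
      {{ℚ.nonNegative (ℚₚ.<⇒≤ (mul-pos 0<δ 0<δ))}} (begin-strict
      (δ ℚ.* δ) ℚ.* ℚ.∣ i ℚ.- j ∣
        ≤⟨ ℚₚ.*-monoʳ-≤-nonNeg ℚ.∣ i ℚ.- j ∣ {{ℚₚ.∣-∣-nonNeg (i ℚ.- j)}}
             (mul-mono-≤ (ℚₚ.<⇒≤ 0<δ) (ℚₚ.<⇒≤ 0<b) δ≤a δ≤b) ⟩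
      (a ℚ.* b) ℚ.* ℚ.∣ i ℚ.- j ∣
        ≡⟨ cong (ℚ._* ℚ.∣ i ℚ.- j ∣) (sym (ℚₚ.0≤p⇒∣p∣≡p (ℚₚ.<⇒≤ (mul-pos 0<a 0<b)))) ⟩
      ℚ.∣ a ℚ.* b ∣ ℚ.* ℚ.∣ i ℚ.- j ∣
        ≡⟨ sym (ℚₚ.∣p*q∣≡∣p∣*∣q∣ (a ℚ.* b) (i ℚ.- j)) ⟩
      ℚ.∣ (a ℚ.* b) ℚ.* (i ℚ.- j) ∣
        ≡⟨ cong ℚ.∣_∣ (inv-rearrange a b i j) ⟩
      ℚ.∣ b ℚ.* (a ℚ.* i) ℚ.- a ℚ.* (b ℚ.* j) ∣
        ≡⟨ cong₂ (λ u v → ℚ.∣ b ℚ.* u ℚ.- a ℚ.* v ∣) ai≡1 bj≡1 ⟩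
      ℚ.∣ b ℚ.* 1ℚ ℚ.- a ℚ.* 1ℚ ∣
        ≡⟨ cong₂ (λ u v → ℚ.∣ u ℚ.- v ∣) (ℚₚ.*-identityʳ b) (ℚₚ.*-identityʳ a) ⟩
      ℚ.∣ b ℚ.- a ∣
        <⟨ h ⟩
      (δ ℚ.* δ) ℚ.* η ∎)
      where open ℚₚ.≤-Reasoning

  inv-cauchy : ∀ x {δ} → Cauchy x → 0ℚ ℚ.< δ →
    (∃[ N ] ∀ n → N ℕ.≤ n → 0ℚ ℚ.+ δ ℚ.≤ x n) → Cauchy (λ n → invℚ (x n))
  inv-cauchy x {δ} cx 0<δ (M , hM) ε 0<ε =
    conclude (cx ((δ ℚ.* δ) ℚ.* ε) (mul-pos (mul-pos 0<δ 0<δ) 0<ε))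
    where
    δ≤x : ∀ n → M ℕ.≤ n → δ ℚ.≤ x n
    δ≤x n p = subst (ℚ._≤ x n) (ℚₚ.+-identityˡ δ) (hM n p)
    conclude :
      (∃[ N ] ∀ m n → N ℕ.≤ m → N ℕ.≤ n → ℚ.∣ x m ℚ.- x n ∣ ℚ.< (δ ℚ.* δ) ℚ.* ε) →
      ∃[ N ] ∀ m n → N ℕ.≤ m → N ℕ.≤ n → ℚ.∣ invℚ (x m) ℚ.- invℚ (x n) ∣ ℚ.< ε
    conclude (N , h) = M ℕ.⊔ N , λ m n p q → inv-bound (x m) (x n) 0<δ
      (δ≤x m (ℕₚ.m⊔n≤o⇒m≤o M N p)) (δ≤x n (ℕₚ.m⊔n≤o⇒m≤o M N q))
      (h n m (ℕₚ.m⊔n≤o⇒n≤o M N q) (ℕₚ.m⊔n≤o⇒n≤o M N p))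

infix  8 _⁻¹[_]

_⁻¹[_] : (x : ℝ) → 0ℝ < x → ℝ
seq    (x ⁻¹[ _ ]) n = invℚ (seq x n)
cauchy (x ⁻¹[ δ , 0<δ , 0<x ]) = inv-cauchy (seq x) (cauchy x) 0<δ 0<x

x<y⇒0<y-x : ∀ {x y} → x < y → 0ℝ < y - x
x<y⇒0<y-x {x} {y} (ε , 0<ε , N , h) = ε , 0<ε , N , λ n p →
  subst (ℚ._≤ seq y n ℚ.- seq x n) (cancel (seq x n) ε)
    (ℚₚ.+-monoˡ-≤ (ℚ.- seq x n) (h n p))
  where
  cancel : ∀ a e → (a ℚ.+ e) ℚ.- a ≡ 0ℚ ℚ.+ e
  cancel = solve 2 (λ a e → (a :+ e) :- a := con 0ℚ :+ e) refl

-- Coefficients in increasing order of degree.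
evalPoly : List ℝ → ℝ → ℝ
evalPoly []       x = 0ℝ
evalPoly (a ∷ as) x = a + x * evalPoly as x

infixl 7 _/[1-_][_]

_/[1-_][_] : ℝ → (α : ℝ) → α < 1ℝ → ℝ
x /[1- α ][ α<1 ] = x * (1ℝ - α) ⁻¹[ x<y⇒0<y-x {α} {1ℝ} α<1 ]

-- y is the value C(α,d).  The case distinction on reals is not decidable, so C
-- is given by its graph; since ≃ is ¬¬-stable, the clauses determine y up to ≃.
record IsC (α : ℝ) (α<1 : α < 1ℝ) (d y : ℝ) : Set where
  field
    low  : d ≤ α * α * ½ℝ → y ≃ 0ℝ
    mid  : α * α * ½ℝ < d → d ≤ α * (1ℝ - α * ½ℝ) →
           y ≃ α /[1- α ][ α<1 ] * ((2ℝ * d - α * α) * ½ℝ)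
    high : α * (1ℝ - α * ½ℝ) < d →
           y ≃ (2ℝ * α) /[1- α ][ α<1 ] * (2ℝ * d - α * α) - 3ℝ * (α * α)

-- m is the maximum of C(α,c₂/2) over α ∈ (0,1).  Attainment is stated
-- classically: a maximizer does not depend continuously on c₂, so it cannot be
-- computed from c₂, although the value m can.
record Is-c₁* (c₂ m : ℝ) : Set where
  field
    upperBound : ∀ α → 0ℝ < α → (α<1 : α < 1ℝ) →
                 ∀ y → IsC α α<1 (c₂ * ½ℝ) y → y ≤ m
    attained   : ¬ ¬ (∃[ α ] 0ℝ < α × Σ[ α<1 ∈ α < 1ℝ ] IsC α α<1 (c₂ * ½ℝ) m)

record 3UniformHypergraph (n : ℕ) : Set where
  field
    edges   : List (Subset n)
    unique  : Unique edges
    uniform : All (λ e → ∣ e ∣ ≡ 3) edges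

  degree : Fin n → ℕ
  degree v = length (filter (v ∈?_) edges)

open 3UniformHypergraph public using (degree)

DegreeSequence : ℕ → Set
DegreeSequence n = Vec ℕ n

_IsRealizationOf_ : ∀ {n} → 3UniformHypergraph n → DegreeSequence n → Set
H IsRealizationOf D = ∀ i → degree H i ≡ lookup D i

Graphic : ∀ {n} → DegreeSequence n → Set
Graphic D = ∃[ H ] H IsRealizationOf D

DegreesBetween : ℝ → ℝ → ∀ {n} → DegreeSequence n → Set
DegreesBetween c₁ c₂ {n} D = ∀ i →
  c₁ * fromℕ ((n ℕ.∸ 1) C 2) ≤ fromℕ (lookup D i) ×
  fromℕ (lookup D i) ≤ c₂ * fromℕ ((n ℕ.∸ 1) C 2)

𝒟 : ℝ → ℝ → ∀ {n} → DegreeSequence n → Set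
𝒟 c₁ c₂ D = 3 ∣ sum D × DegreesBetween c₁ c₂ D

{-# OPTIONS --safe #-}
-- If deg i > deg j, some edge can exchange i for j, so the degree of i drops by one and that
-- of j grows by one.  Such transfers lead from a hypergraph to a realization of D as soon as,
-- for some set S of K vertices of largest degree in D and a ≤ D ≤ b, the degrees sum to at
-- least K b on S and to at most (n − K) a off S.  Take for K the least number for which
-- K b + (n − K) a reaches the sum of D, and fill in the edges with 3, 2, 1, 0 vertices in S,
-- in this order.  If the sum on S is still too small, the filling stops among the edges with
-- 2 or 1 vertices in S; comparing both sums with c₁ > C(α, c₂/2) + 1/u at α = K/n bounds n − K
-- by a multiple of u.  For larger K all edges fit inside a set of n − 13u − 1 vertices, because
-- c₁ > c₁* keeps c₂ away from 1.  So n₀ = 336 u³ works, with u of the order of 1/(c₁ − c₁*).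
module Submission where

-- The value C(α, c₂/2) is the largest of 0 and its two nonconstant formulas, and each formula
-- excludes one way for the filling to fail. If the filling stops among the edges with 2 vertices in
-- S, eliminating the number of these edges from "sum on S too small" and "K is least" gives, to
-- leading order, the reverse of the middle formula's bound at α = K/n; with 1 vertex in S it is the
-- last formula. The discarded lower-order terms (`K C 3` against K³/6, the rounding of K) are at
-- most a constant times N = C(n-1, 2), whereas the surplus 1/u in c₁ contributes about (n - K) N /
-- u. Hence the argument needs n - K of order u, and K close to n has to be treated apart. Reals are
-- Cauchy sequences whose comparison is undecidable, so the regime of C is known only under double
-- negation. This does no harm: the outcome `Dense` consists of inequalities between natural
-- numbers, which are decidable, and the combinatorial part never meets a real number.

module Combinatorics where

  open import Data.Bool.Base using (Bool; true; false; not)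
  import Data.Bool.Properties as Boolₚ
  open import Data.Empty using (⊥)
  open import Data.Fin.Base using (Fin; zero; suc)
  open import Data.Fin.Permutation using (Permutation′; _⟨$⟩ʳ_; _⟨$⟩ˡ_; inverseʳ; transpose)
  open import Data.Fin.Properties using (_≟_) renaming (any? to anyFin?)
  open import Data.Fin.Subset using (Subset; ∣_∣; ∁; _∈_) renaming (⊥ to ∅)
  open import Data.Fin.Subset.Properties using (_∈?_; ∣⊥∣≡0; ∣∁p∣≡n∸∣p∣)
  open import Data.List.Base using (List; []; _∷_; _++_; length; filter; map; take; concat; allFin)
  open import Data.List.Membership.Propositional using (find) renaming (_∈_ to _∈ₗ_; _∉_ to _∉ₗ_)
  open import Data.List.Membership.Propositional.Properties
    using (∈-∃++; ∈-map⁻; ∈-map∘filter⁻; ∈-filter⁺; ∈-filter⁻; ∈-allFin)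
  import Data.List.Properties as Listₚ
  open import Data.List.Relation.Binary.Disjoint.Propositional using (Disjoint)
  open import Data.List.Relation.Binary.Permutation.Propositional using (_↭_; ↭-sym; ↭⇒↭ₛ)
  open import Data.List.Relation.Binary.Permutation.Propositional.Properties
    using (shift; All-resp-↭; ↭-length; ∈-resp-↭)
  import Data.List.Relation.Binary.Permutation.Setoid.Properties as Permₛ
  open import Data.List.Relation.Unary.All as All using (All; []; _∷_)
  import Data.List.Relation.Unary.All.Properties as Allₚ
  open import Data.List.Relation.Unary.AllPairs using ([]; _∷_)
  open import Data.List.Relation.Unary.Any using (here; there; any?)
  open import Data.List.Relation.Unary.Unique.Propositional using (Unique)
  import Data.List.Relation.Unary.Unique.Propositional.Properties as Uniqueₚ
  open import Data.Nat.Base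
  open import Data.Nat.Combinatorics using (_C_; nC1≡n; nCk+nC[k+1]≡[n+1]C[k+1])
  open import Data.Nat.Properties hiding (_≟_)
  open import Data.Nat.Tactic.RingSolver using (solve-∀)
  open import Data.Product using (_×_; _,_; ∃-syntax; proj₁; proj₂)
  open import Data.Sum.Base using (_⊎_; inj₁; inj₂)
  open import Data.Vec.Base using (Vec; []; _∷_; lookup; tabulate; _[_]≔_) renaming (sum to sumᵥ)
  import Data.Vec.Properties as Vecₚ
  open import Function.Base using (_∘_)
  open import Relation.Binary.PropositionalEquality
  open import Relation.Nullary using (¬_; Dec; yes; no; does; contradiction; ¬?; _×-dec_)
  open import Algebra.Properties.Semiring.Sum +-*-semiring
    using (sum-cong-≗; sum-permute; sum-replicate-zero; ∑-distrib-+; *-distribʳ-sum) renaming (sum to ∑)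
  open import Data.List.Extrema ≤-totalOrder
    using (argmin; argmax; argmax-all; f[argmin]≤f[xs]; f[xs]≤f[argmax])

  private variable
    n : ℕ

  -- Degree transfers

  _∈?ₗ_ : (e : Subset n) (es : List (Subset n)) → Dec (e ∈ₗ es)
  e ∈?ₗ es = any? (Vecₚ.≡-dec Boolₚ._≟_ e) es

  χ : Bool → ℕ
  χ true  = 1
  χ false = 0

  δ : Fin n → Fin n → ℕ
  δ i v = χ (does (i ≟ v))

  δ-refl : (i : Fin n) → δ i i ≡ 1
  δ-refl i with i ≟ i
  ... | yes _ = refl
  ... | no i≢i = contradiction refl i≢i

  δ-≢ : {i v : Fin n} → i ≢ v → δ i v ≡ 0
  δ-≢ {i = i} {v} i≢v with i ≟ v
  ... | yes i≡v = contradiction i≡v i≢v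
  ... | no _ = refl

  incidence : Subset n → Fin n → ℕ
  incidence e v = χ (lookup e v)

  deg : List (Subset n) → Fin n → ℕ
  deg []       v = 0
  deg (e ∷ es) v = incidence e v + deg es v

  deg≡length : (es : List (Subset n)) (v : Fin n) → length (filter (v ∈?_) es) ≡ deg es v
  deg≡length []       v = refl
  deg≡length (e ∷ es) v with v ∈? e
  ... | yes v∈e rewrite Vecₚ.[]=⇒lookup v∈e = cong suc (deg≡length es v)
  ... | no v∉e with lookup e v in eq
  ...   | true  = contradiction (Vecₚ.lookup⇒[]= v e eq) v∉e
  ...   | false = deg≡length es v

  deg-++ : (es fs : List (Subset n)) (v : Fin n) → deg (es ++ fs) v ≡ deg es v + deg fs v
  deg-++ []       fs v = refl
  deg-++ (e ∷ es) fs v = trans (cong (incidence e v +_) (deg-++ es fs v))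
    (sym (+-assoc (incidence e v) (deg es v) (deg fs v)))

  ∣∣≡∑ : (e : Subset n) → ∣ e ∣ ≡ ∑ (incidence e)
  ∣∣≡∑ []          = refl
  ∣∣≡∑ (true ∷ e)  = cong suc (∣∣≡∑ e)
  ∣∣≡∑ (false ∷ e) = ∣∣≡∑ e

  Simple3 : List (Subset n) → Set
  Simple3 es = Unique es × All (λ e → ∣ e ∣ ≡ 3) es

  Simple3-resp-↭ : {es fs : List (Subset n)} → es ↭ fs → Simple3 es → Simple3 fs
  Simple3-resp-↭ p (u , a) =
    Permₛ.Unique-resp-↭ (setoid _) (↭⇒↭ₛ p) u , All-resp-↭ p a

  Unique-⊆-length : ∀ {A : Set} {xs ys : List A} → Unique xs → (∀ {x} → x ∈ₗ xs → x ∈ₗ ys) →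
    length xs ≤ length ys
  Unique-⊆-length []          _ = z≤n
  Unique-⊆-length {xs = x ∷ xs} (x∉xs ∷ u) xs⊆ys with ∈-∃++ (xs⊆ys (here refl))
  ... | as , bs , refl = subst (suc (length xs) ≤_) (sym (↭-length (shift x as bs)))
    (s≤s (Unique-⊆-length u λ z∈xs → drop-x z∈xs (∈-resp-↭ (shift x as bs) (xs⊆ys (there z∈xs)))))
    where
    drop-x : ∀ {z} → z ∈ₗ xs → z ∈ₗ x ∷ as ++ bs → z ∈ₗ as ++ bs
    drop-x z∈xs (here refl) = contradiction z∈xs (Allₚ.All¬⇒¬Any x∉xs)
    drop-x z∈xs (there q)   = q

  relabel : Permutation′ n → Subset n → Subset n
  relabel π e = tabulate λ v → lookup e (π ⟨$⟩ʳ v)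

  relabel-injective : (π : Permutation′ n) {e f : Subset n} → relabel π e ≡ relabel π f → e ≡ f
  relabel-injective π {e} {f} eq = trans (sym (Vecₚ.tabulate∘lookup e))
    (trans (Vecₚ.tabulate-cong same) (Vecₚ.tabulate∘lookup f))
    where
    at : ∀ g v → lookup g v ≡ lookup (relabel π g) (π ⟨$⟩ˡ v)
    at g v = trans (cong (lookup g) (sym (inverseʳ π))) (sym (Vecₚ.lookup∘tabulate _ (π ⟨$⟩ˡ v)))
    same : ∀ v → lookup e v ≡ lookup f v
    same v = trans (at e v) (trans (cong (λ g → lookup g (π ⟨$⟩ˡ v)) eq) (sym (at f v)))

  ∣relabel∣ : (π : Permutation′ n) (e : Subset n) → ∣ relabel π e ∣ ≡ ∣ e ∣
  ∣relabel∣ π e = begin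
    ∣ relabel π e ∣                     ≡⟨ ∣∣≡∑ (relabel π e) ⟩
    ∑ (incidence (relabel π e))         ≡⟨ sum-cong-≗ {x = incidence (relabel π e)}
                                             (λ v → cong χ (Vecₚ.lookup∘tabulate _ v)) ⟩
    ∑ (λ v → incidence e (π ⟨$⟩ʳ v))    ≡⟨ sym (sum-permute (incidence e) π) ⟩
    ∑ (incidence e)                     ≡⟨ sym (∣∣≡∑ e) ⟩
    ∣ e ∣                               ∎
    where open ≡-Reasoning

  swap : Fin n → Fin n → Subset n → Subset n
  swap i j = relabel (transpose i j)

  lookup-swap-j : (i j : Fin n) (e : Subset n) → lookup (swap i j e) j ≡ lookup e i
  lookup-swap-j i j e = trans (Vecₚ.lookup∘tabulate _ j) (cong (lookup e) (eq i j))
    where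
    eq : (i j : Fin _) → transpose i j ⟨$⟩ʳ j ≡ i
    eq i j with j ≟ i
    ... | yes j≡i = j≡i
    ... | no _ with j ≟ j
    ...   | yes _ = refl
    ...   | no j≢j = contradiction refl j≢j

  lookup-swap-i : (i j : Fin n) (e : Subset n) → lookup (swap i j e) i ≡ lookup e j
  lookup-swap-i i j e = trans (Vecₚ.lookup∘tabulate _ i) (cong (lookup e) (eq i j))
    where
    eq : (i j : Fin _) → transpose i j ⟨$⟩ʳ i ≡ j
    eq i j with i ≟ i
    ... | yes _ = refl
    ... | no i≢i = contradiction refl i≢i

  lookup-swap : {i j : Fin n} (e : Subset n) {v : Fin n} → i ≢ v → j ≢ v →
    lookup (swap i j e) v ≡ lookup e v
  lookup-swap {i = i} {j} e {v} i≢v j≢v = trans (Vecₚ.lookup∘tabulate _ v) (cong (lookup e) eq)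
    where
    eq : transpose i j ⟨$⟩ʳ v ≡ v
    eq with v ≟ i
    ... | yes v≡i = contradiction (sym v≡i) i≢v
    ... | no _ with v ≟ j
    ...   | yes v≡j = contradiction (sym v≡j) j≢v
    ...   | no _ = refl

  -- This is d′ = d - δᵢ + δⱼ with each correction written on the side where it is added, so that no
  -- truncated subtraction occurs.
  record _≈[_↦_]_ (d : Fin n → ℕ) (i j : Fin n) (d′ : Fin n → ℕ) : Set where
    constructor mk≈
    field
      balance : ∀ v → d′ v + δ i v ≡ d v + δ j v

  open _≈[_↦_]_

  incidence-swap : {i j : Fin n} (e : Subset n) → lookup e i ≡ true → lookup e j ≡ false →
    ∀ v → incidence (swap i j e) v + δ i v ≡ incidence e v + δ j v
  incidence-swap {i = i} {j} e i∈e j∉e v with i ≟ v | j ≟ v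
  ... | yes refl | yes refl = contradiction (trans (sym i∈e) j∉e) λ ()
  ... | yes refl | no _ rewrite lookup-swap-i i j e | i∈e | j∉e = refl
  ... | no _ | yes refl rewrite lookup-swap-j i j e | i∈e | j∉e = refl
  ... | no i≢v | no j≢v rewrite lookup-swap {i = i} {j} e i≢v j≢v = refl

  -- If swapping i for j never produced a new edge, it would embed the edges at i into those at j.
  switchable : {i j : Fin n} (es : List (Subset n)) → Unique es → deg es j < deg es i →
    ∃[ e ] e ∈ₗ es × lookup e i ≡ true × swap i j e ∉ₗ es
  switchable {i = i} {j} es u dj<di
    with any? (λ e → lookup e i Boolₚ.≟ true ×-dec ¬? (swap i j e ∈?ₗ es)) es
  ... | yes p = find p
  ... | no ¬p = contradiction dj<di (≤⇒≯ (subst₂ _≤_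
      (trans (Listₚ.length-map (swap i j) (filter (i ∈?_) es)) (deg≡length es i)) (deg≡length es j)
      (Unique-⊆-length
        (Uniqueₚ.map⁺ (relabel-injective (transpose i j)) (Uniqueₚ.filter⁺ {P = i ∈_} (i ∈?_) u)) embed)))
    where
    closed : ∀ {e} → e ∈ₗ es → i ∈ e → swap i j e ∈ₗ es
    closed {e} e∈es i∈e with swap i j e ∈?ₗ es
    ... | yes q = q
    ... | no ¬q = contradiction (Vecₚ.[]=⇒lookup i∈e , ¬q) (All.lookup (Allₚ.¬Any⇒All¬ es ¬p) e∈es)
    embed : ∀ {f} → f ∈ₗ map (swap i j) (filter (i ∈?_) es) → f ∈ₗ filter (j ∈?_) es
    embed f∈ with ∈-map∘filter⁻ (swap i j) {P = i ∈_} (i ∈?_) f∈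
    ... | e , e∈es , refl , i∈e = ∈-filter⁺ {P = j ∈_} (j ∈?_) (closed e∈es i∈e)
      (Vecₚ.lookup⇒[]= j _ (trans (lookup-swap-j i j e) (Vecₚ.[]=⇒lookup i∈e)))

  -- Shows in `switch` that the edge found by `switchable` misses `j`: an edge containing both
  -- vertices would be its own image, hence not a new edge.
  swap-fixes : {i j : Fin n} (e : Subset n) → lookup e i ≡ lookup e j → swap i j e ≡ e
  swap-fixes {i = i} {j} e eq = trans (Vecₚ.tabulate-cong same) (Vecₚ.tabulate∘lookup e)
    where
    same : ∀ v → lookup e (transpose i j ⟨$⟩ʳ v) ≡ lookup e v
    same v with v ≟ i
    ... | yes refl = sym eq
    ... | no _ with v ≟ j
    ...   | yes refl = eq
    ...   | no _ = refl

  switch : {i j : Fin n} (es : List (Subset n)) → Simple3 es → deg es j < deg es i →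
    ∃[ fs ] Simple3 fs × deg es ≈[ i ↦ j ] deg fs
  switch {i = i} {j} es s dj<di with switchable es (proj₁ s) dj<di
  ... | e , e∈es , i∈e , e′∉es with lookup e j in j∉e
  ...   | true = contradiction (subst (_∈ₗ es) (sym (swap-fixes e (trans i∈e (sym j∉e)))) e∈es) e′∉es
  ...   | false with ∈-∃++ e∈es
  ...     | as , bs , refl = exchange (Simple3-resp-↭ (shift e as bs) s)
      (λ q → e′∉es (∈-resp-↭ (↭-sym (shift e as bs)) (there q)))
    where
    e′ : Subset _
    e′ = swap i j e
    rearrange : ∀ x y a b c d → x + c ≡ y + d → (x + (a + b)) + c ≡ (a + (y + b)) + d
    rearrange x y a b c d eq = trans (l x a b c) (trans (cong (_+ (a + b)) eq) (r y a b d))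
      where
      l : ∀ x a b c → (x + (a + b)) + c ≡ (x + c) + (a + b)
      l = solve-∀
      r : ∀ y a b d → (y + d) + (a + b) ≡ (a + (y + b)) + d
      r = solve-∀
    exchange : Simple3 (e ∷ as ++ bs) → e′ ∉ₗ as ++ bs →
      ∃[ fs ] Simple3 fs × deg (as ++ e ∷ bs) ≈[ i ↦ j ] deg fs
    exchange (_ ∷ u , ∣e∣≡3 ∷ a) e′∉ =
      e′ ∷ as ++ bs , (Allₚ.¬Any⇒All¬ _ e′∉ ∷ u , trans (∣relabel∣ (transpose i j) e) ∣e∣≡3 ∷ a) , mk≈ λ v →
        trans (cong (λ t → (incidence e′ v + t) + δ i v) (deg-++ as bs v))
          (trans (rearrange (incidence e′ v) (incidence e v) (deg as v) (deg bs v) (δ i v) (δ j v)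
                   (incidence-swap e i∈e j∉e v))
            (cong (_+ δ j v) (sym (deg-++ as (e ∷ bs) v))))

  -- Sums over vertices under a degree transfer

  ∑-mono-≤ : (f g : Fin n → ℕ) → (∀ v → f v ≤ g v) → ∑ f ≤ ∑ g
  ∑-mono-≤ {zero}  f g f≤g = z≤n
  ∑-mono-≤ {suc n} f g f≤g = +-mono-≤ (f≤g zero) (∑-mono-≤ (λ v → f (suc v)) (λ v → g (suc v)) λ v → f≤g (suc v))

  ∑-mono-< : (f g : Fin n → ℕ) → (∀ v → f v ≤ g v) → (i : Fin n) → f i < g i → ∑ f < ∑ g
  ∑-mono-< f g f≤g zero    fi<gi = +-mono-<-≤ fi<gi (∑-mono-≤ _ _ λ v → f≤g (suc v))
  ∑-mono-< f g f≤g (suc i) fi<gi = +-mono-≤-< (f≤g zero) (∑-mono-< _ _ (λ v → f≤g (suc v)) i fi<gi)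

  ∑-δ : (w : Fin n → ℕ) (i : Fin n) → ∑ (λ v → w v * δ i v) ≡ w i
  ∑-δ w zero    = trans (cong₂ _+_ (*-identityʳ (w zero)) (vanish λ v → w (suc v))) (+-identityʳ (w zero))
    where
    vanish : ∀ {m} (f : Fin m → ℕ) → ∑ (λ v → f v * 0) ≡ 0
    vanish {zero}  f = refl
    vanish {suc m} f = cong₂ _+_ (*-zeroʳ (f zero)) (vanish λ v → f (suc v))
  ∑-δ w (suc i) = cong₂ _+_ (*-zeroʳ (w zero)) (∑-δ (λ v → w (suc v)) i)

  -- Two weights matter: with `w` the indicator of a set, the sum over the set is unchanged if `i`
  -- and `j` lie on the same side; with `w` constant 1, the total is unchanged.
  ∑-transfer : (w : Fin n → ℕ) {d d′ : Fin n → ℕ} {i j : Fin n} → d ≈[ i ↦ j ] d′ →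
    ∑ (λ v → w v * d′ v) + w i ≡ ∑ (λ v → w v * d v) + w j
  ∑-transfer w {d} {d′} {i} {j} eq = begin
    ∑ (λ v → w v * d′ v) + w i                      ≡⟨ cong (∑ (λ v → w v * d′ v) +_) (∑-δ w i) ⟨
    ∑ (λ v → w v * d′ v) + ∑ (λ v → w v * δ i v)    ≡⟨ distrib d′ i ⟩
    ∑ (λ v → w v * (d′ v + δ i v))                  ≡⟨ sum-cong-≗ {x = λ v → w v * (d′ v + δ i v)}
                                                         (λ v → cong (w v *_) (balance eq v)) ⟩
    ∑ (λ v → w v * (d v + δ j v))                   ≡⟨ distrib d j ⟨
    ∑ (λ v → w v * d v) + ∑ (λ v → w v * δ j v)     ≡⟨ cong (∑ (λ v → w v * d v) +_) (∑-δ w j) ⟩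
    ∑ (λ v → w v * d v) + w j                       ∎
    where
    open ≡-Reasoning
    distrib : ∀ d i → ∑ (λ v → w v * d v) + ∑ (λ v → w v * δ i v) ≡ ∑ (λ v → w v * (d v + δ i v))
    distrib d i = trans (sym (∑-distrib-+ (λ v → w v * d v) (λ v → w v * δ i v)))
      (sum-cong-≗ {x = λ v → w v * d v + w v * δ i v} λ v → sym (*-distribˡ-+ (w v) (d v) (δ i v)))

  sumOver : Subset n → (Fin n → ℕ) → ℕ
  sumOver S d = ∑ λ v → incidence S v * d v

  sumOver-const : (S : Subset n) (b : ℕ) → sumOver S (λ _ → b) ≡ ∣ S ∣ * b
  sumOver-const S b = trans (sym (*-distribʳ-sum b (incidence S))) (cong (_* b) (sym (∣∣≡∑ S)))

  module _ (S : Subset n) {d d′ : Fin n → ℕ} (d≤d′ : ∀ v → lookup S v ≡ true → d v ≤ d′ v) where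

    private
      pointwise : ∀ v → incidence S v * d v ≤ incidence S v * d′ v
      pointwise v with lookup S v in eq
      ... | true  = *-monoʳ-≤ 1 (d≤d′ v eq)
      ... | false = z≤n

    sumOver-mono-< : (j : Fin n) → lookup S j ≡ true → d j < d′ j → sumOver S d < sumOver S d′
    sumOver-mono-< j j∈S dj<d′j = ∑-mono-< _ _ pointwise j strict
      where
      strict : incidence S j * d j < incidence S j * d′ j
      strict rewrite j∈S = *-monoʳ-< 1 dj<d′j

  -- An averaging argument: if no vertex of `S` exceeded `b`, the deficient vertex `j` would push
  -- the sum strictly below `∣ S ∣ * b`.
  above-average : (S : Subset n) (d : Fin n → ℕ) {b : ℕ} {j : Fin n} → ∣ S ∣ * b ≤ sumOver S d →
    lookup S j ≡ true → d j < b → ∃[ i ] lookup S i ≡ true × b < d i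
  above-average S d {b} {j} le j∈S dj<b with anyFin? (λ i → (lookup S i Boolₚ.≟ true) ×-dec (b <? d i))
  ... | yes p = p
  ... | no ¬p = contradiction (sumOver-mono-< S (λ v v∈S → ≮⇒≥ λ b<dv → ¬p (v , v∈S , b<dv)) j j∈S dj<b)
    (≤⇒≯ (subst (_≤ sumOver S d) (sym (sumOver-const S b)) le))

  below-average : (S : Subset n) (d : Fin n → ℕ) {a : ℕ} {i : Fin n} → sumOver S d ≤ ∣ S ∣ * a →
    lookup S i ≡ true → a < d i → ∃[ j ] lookup S j ≡ true × d j < a
  below-average S d {a} {i} le i∈S a<di with anyFin? (λ j → (lookup S j Boolₚ.≟ true) ×-dec (d j <? a))
  ... | yes p = p
  ... | no ¬p = contradiction (sumOver-mono-< S (λ v v∈S → ≮⇒≥ λ dv<a → ¬p (v , v∈S , dv<a)) i i∈S a<di)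
    (≤⇒≯ (subst (sumOver S d ≤_) (sym (sumOver-const S a)) le))

  module _ (D : Fin n → ℕ) {d d′ : Fin n → ℕ} {i j : Fin n} (moved : d ≈[ i ↦ j ] d′)
    (over : D i < d i) (under : d j < D j) where

    private
      j≢i : j ≢ i
      j≢i refl = <-asym over under

    -- Only `i` loses a unit, and `i` was strictly above `D`. Dually, in `transfer-keeps-≤` only `j`
    -- gains one and was strictly below.
    transfer-keeps-≥ : ∀ v → D v ≤ d v → D v ≤ d′ v
    transfer-keeps-≥ v D≤d with i ≟ v | balance moved v
    ... | yes refl | eq = s≤s⁻¹ (≤-trans over (≤-trans (m≤m+n (d i) (δ j i))
                            (≤-reflexive (trans (sym eq) (+-comm (d′ i) 1)))))
    ... | no _ | eq = ≤-trans D≤d (≤-trans (m≤m+n (d v) (δ j v))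
                            (≤-reflexive (trans (sym eq) (+-identityʳ (d′ v)))))

    transfer-keeps-≤ : ∀ v → d v ≤ D v → d′ v ≤ D v
    transfer-keeps-≤ v d≤D with j ≟ v | balance moved v
    ... | yes refl | eq = ≤-trans (m≤m+n (d′ j) (δ i j)) (≤-trans (≤-reflexive (trans eq (+-comm (d j) 1))) under)
    ... | no _ | eq = ≤-trans (m≤m+n (d′ v) (δ i v)) (≤-trans (≤-reflexive (trans eq (+-identityʳ (d v)))) d≤D)

    -- The termination measure of the levelling. The unit lost at `i` is a unit of excess, while the
    -- unit gained at `j` creates none, since `j` was strictly below `D`.
    excess-decreases : ∑ (λ v → d′ v ∸ D v) < ∑ (λ v → d v ∸ D v)
    excess-decreases = ∑-mono-< _ _ pointwise i
      (∸-monoˡ-< (≤-reflexive (trans (+-comm 1 (d′ i)) lost)) (transfer-keeps-≥ i (<⇒≤ over)))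
      where
      lost : d′ i + 1 ≡ d i
      lost = trans (cong (d′ i +_) (sym (δ-refl i))) (trans (balance moved i)
        (trans (cong (d i +_) (δ-≢ j≢i)) (+-identityʳ (d i))))
      pointwise : ∀ v → d′ v ∸ D v ≤ d v ∸ D v
      pointwise v with j ≟ v | balance moved v
      ... | yes refl | _  = ≤-trans (≤-reflexive (m≤n⇒m∸n≡0 (transfer-keeps-≤ j (<⇒≤ under)))) z≤n
      ... | no _     | eq = ∸-monoˡ-≤ (D v) (≤-trans (m≤m+n (d′ v) (δ i v))
                              (≤-reflexive (trans eq (+-identityʳ (d v)))))

  ≤-∑-≡ : (f g : Fin n → ℕ) → (∀ v → f v ≤ g v) → ∑ f ≡ ∑ g → ∀ v → f v ≡ g v
  ≤-∑-≡ f g f≤g eq v with f v <? g v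
  ... | yes fv<gv = contradiction eq (<⇒≢ (∑-mono-< f g f≤g v fv<gv))
  ... | no fv≮gv  = ≤-antisym (f≤g v) (≮⇒≥ fv≮gv)

  -- Transfers inside S and inside its complement first lift all of S above D and push the
  -- complement below D; after that only transfers from S to its complement are needed.
  module Levelling {n} (S : Subset n) {a b : ℕ} (D : Fin n → ℕ)
    (a≤D : ∀ v → a ≤ D v) (D≤b : ∀ v → D v ≤ b)
    (top : ∀ i j → lookup S i ≡ true → lookup S j ≡ false → D j ≤ D i) where

    -- The left alternatives are what the filling provides; they survive transfers that stay on one
    -- side of `S`. The right alternatives survive every transfer from a vertex above `D` to one
    -- below, so transfers across `S` may begin once both hold.
    Heavy Light : (Fin n → ℕ) → Set
    Heavy d = ∣ S ∣ * b ≤ sumOver S d ⊎ (∀ v → lookup S v ≡ true → D v ≤ d v)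
    Light d = sumOver (∁ S) d ≤ ∣ ∁ S ∣ * a ⊎ (∀ v → lookup S v ≡ false → d v ≤ D v)

    private
      lookup-∁ : ∀ v → lookup (∁ S) v ≡ not (lookup S v)
      lookup-∁ v = Vecₚ.lookup-map v not S

      sumOver-transfer : ∀ (T : Subset n) {d d′ i j} → d ≈[ i ↦ j ] d′ → lookup T i ≡ lookup T j →
        sumOver T d′ ≡ sumOver T d
      sumOver-transfer T {d} {d′} {i} {j} moved eq = +-cancelʳ-≡ (incidence T i) (sumOver T d′) (sumOver T d)
        (trans (∑-transfer (incidence T) moved) (cong (_ +_) (cong χ (sym eq))))

      total-transfer : ∀ {d d′ : Fin n → ℕ} {i j : Fin n} → d ≈[ i ↦ j ] d′ → ∑ d′ ≡ ∑ d
      total-transfer {d} {d′} moved = +-cancelʳ-≡ 1 _ _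
        (trans (cong (_+ 1) (unit d′)) (trans (∑-transfer (λ _ → 1) moved) (cong (_+ 1) (sym (unit d)))))
        where
        unit : ∀ d → ∑ d ≡ ∑ (λ v → 1 * d v)
        unit d = sum-cong-≗ {x = d} λ v → sym (*-identityˡ (d v))

    level : ∀ fuel es → Simple3 es → ∑ (λ v → deg es v ∸ D v) < fuel → ∑ (deg es) ≡ ∑ D →
      Heavy (deg es) → Light (deg es) → ∃[ fs ] Simple3 fs × (∀ v → deg fs v ≡ D v)
    level (suc fuel) es simple (s≤s bound) total heavy light = by-light light
      where
      d = deg es

      Result : Set
      Result = ∃[ fs ] Simple3 fs × (∀ v → deg fs v ≡ D v)

      transfer : ∀ {i j} → D i < d i → d j < D j → d j < d i →
        (∀ {d′} → d ≈[ i ↦ j ] d′ → Heavy d′ × Light d′) → Result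
      transfer over under dj<di keep with switch es simple dj<di
      ... | fs , simple′ , moved = level fuel fs simple′
        (<-≤-trans (excess-decreases D moved over under) bound)
        (trans (total-transfer moved) total) (proj₁ (keep moved)) (proj₂ (keep moved))

      heavy-transfer : ∀ {i j d′} → D i < d i → d j < D j → d ≈[ i ↦ j ] d′ →
        lookup S i ≡ lookup S j → Heavy d → Heavy d′
      heavy-transfer over under moved eq (inj₁ h) = inj₁ (subst (_ ≤_) (sym (sumOver-transfer S moved eq)) h)
      heavy-transfer over under moved eq (inj₂ h) = inj₂ λ v v∈S → transfer-keeps-≥ D moved over under v (h v v∈S)

      light-transfer : ∀ {i j d′} → D i < d i → d j < D j → d ≈[ i ↦ j ] d′ →
        lookup S i ≡ lookup S j → Light d → Light d′
      light-transfer {i} {j} over under moved eq (inj₁ h) = inj₁ (subst (_≤ _) (sym (sumOver-transfer (∁ S) moved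
        (trans (lookup-∁ i) (trans (cong not eq) (sym (lookup-∁ j)))))) h)
      light-transfer over under moved eq (inj₂ h) = inj₂ λ v v∉S → transfer-keeps-≤ D moved over under v (h v v∉S)

      inside : ∀ {i j} → D i < d i → d j < D j → d j < d i → lookup S i ≡ lookup S j → Result
      inside over under dj<di eq = transfer over under dj<di λ moved →
        heavy-transfer over under moved eq heavy , light-transfer over under moved eq light

      across : (∀ v → lookup S v ≡ true → D v ≤ d v) → (∀ v → lookup S v ≡ false → d v ≤ D v) → Result
      across high low with anyFin? (λ i → D i <? d i)
      ... | no none = es , simple , ≤-∑-≡ d D (λ v → ≮⇒≥ λ lt → none (v , lt)) total
      ... | yes (i , over) with anyFin? (λ j → d j <? D j)
      ...   | no none = contradiction total
        (λ eq → <⇒≢ (∑-mono-< D d (λ v → ≮⇒≥ λ lt → none (v , lt)) i over) (sym eq))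
      ...   | yes (j , under) with lookup S i in i-side | lookup S j in j-side
      ...     | false | _    = contradiction over (≤⇒≯ (low i i-side))
      ...     | true  | true = contradiction under (≤⇒≯ (high j j-side))
      -- Here `d j < D j ≤ D i < d i`; the middle step is where `S` has to consist of vertices of
      -- largest `D`.
      ...     | true  | false = transfer over under (<-trans under (≤-<-trans (top i j i-side j-side) over)) λ moved →
                inj₂ (λ v v∈S → transfer-keeps-≥ D moved over under v (high v v∈S)) ,
                inj₂ (λ v v∉S → transfer-keeps-≤ D moved over under v (low v v∉S))

      by-heavy : (∀ v → lookup S v ≡ false → d v ≤ D v) → Heavy d → Result
      by-heavy low (inj₂ high) = across high low
      by-heavy low (inj₁ h) with anyFin? (λ j → (lookup S j Boolₚ.≟ true) ×-dec (d j <? D j))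
      ... | no none = across (λ v v∈S → ≮⇒≥ λ lt → none (v , v∈S , lt)) low
      -- A vertex above `b` is also above `D`, so it may give to `j`: `d j < D j ≤ b < d i`.
      ... | yes (j , j∈S , under) with above-average S d h j∈S (<-≤-trans under (D≤b j))
      ...   | i , i∈S , b<di = inside (≤-<-trans (D≤b i) b<di) under
                (<-trans under (≤-<-trans (D≤b j) b<di)) (trans i∈S (sym j∈S))

      by-light : Light d → Result
      by-light (inj₂ low) = by-heavy low heavy
      by-light (inj₁ h) with anyFin? (λ i → (lookup S i Boolₚ.≟ false) ×-dec (D i <? d i))
      ... | no none = by-heavy (λ v v∉S → ≮⇒≥ λ lt → none (v , v∉S , lt)) heavy
      ... | yes (i , i∉S , over) with below-average (∁ S) d h (trans (lookup-∁ i) (cong not i∉S))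
                                                  (≤-<-trans (a≤D i) over)
      ...   | j , j∈∁S , dj<a = inside over (<-≤-trans dj<a (a≤D j))
                (<-trans dj<a (≤-<-trans (a≤D i) over))
                (trans i∉S (sym (Boolₚ.not-injective (trans (sym (lookup-∁ j)) j∈∁S))))

  -- Edges by their number of vertices in a subset

  splits : Subset n → ℕ → ℕ → List (Subset n)
  splits []          zero    zero    = [] ∷ []
  splits []          _       _       = []
  splits (true ∷ S)  zero    u       = map (false ∷_) (splits S zero u)
  splits (true ∷ S)  (suc t) u       = map (true ∷_) (splits S t u) ++ map (false ∷_) (splits S (suc t) u)
  splits (false ∷ S) t       zero    = map (false ∷_) (splits S t zero)
  splits (false ∷ S) t       (suc u) = map (true ∷_) (splits S t u) ++ map (false ∷_) (splits S t (suc u))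

  nC0≡1 : ∀ n → n C 0 ≡ 1
  nC0≡1 zero = refl
  nC0≡1 (suc n) = refl

  splits-length : (S : Subset n) (t u : ℕ) → length (splits S t u) ≡ (∣ S ∣ C t) * (∣ ∁ S ∣ C u)
  splits-length [] zero zero = refl
  splits-length [] zero (suc u) = refl
  splits-length [] (suc t) zero = refl
  splits-length [] (suc t) (suc u) = refl
  splits-length (true ∷ S) zero u = trans (Listₚ.length-map _ (splits S zero u)) (trans (splits-length S zero u)
    (cong (_* (∣ ∁ S ∣ C u)) (trans (nC0≡1 ∣ S ∣) (sym (nC0≡1 (suc ∣ S ∣))))))
  splits-length (true ∷ S) (suc t) u = begin
    length (map (true ∷_) (splits S t u) ++ map (false ∷_) (splits S (suc t) u))
      ≡⟨ Listₚ.length-++ (map (true ∷_) (splits S t u)) ⟩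
    length (map (true ∷_) (splits S t u)) + length (map (false ∷_) (splits S (suc t) u))
      ≡⟨ cong₂ _+_ (Listₚ.length-map _ (splits S t u)) (Listₚ.length-map _ (splits S (suc t) u)) ⟩
    length (splits S t u) + length (splits S (suc t) u)
      ≡⟨ cong₂ _+_ (splits-length S t u) (splits-length S (suc t) u) ⟩
    (∣ S ∣ C t) * (∣ ∁ S ∣ C u) + (∣ S ∣ C suc t) * (∣ ∁ S ∣ C u)
      ≡⟨ *-distribʳ-+ (∣ ∁ S ∣ C u) (∣ S ∣ C t) (∣ S ∣ C suc t) ⟨
    (∣ S ∣ C t + ∣ S ∣ C suc t) * (∣ ∁ S ∣ C u)
      ≡⟨ cong (_* (∣ ∁ S ∣ C u)) (nCk+nC[k+1]≡[n+1]C[k+1] ∣ S ∣ t) ⟩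
    (suc ∣ S ∣ C suc t) * (∣ ∁ S ∣ C u) ∎
    where open ≡-Reasoning
  splits-length (false ∷ S) t zero = trans (Listₚ.length-map _ (splits S t zero)) (trans (splits-length S t zero)
    (cong ((∣ S ∣ C t) *_) (trans (nC0≡1 ∣ ∁ S ∣) (sym (nC0≡1 (suc ∣ ∁ S ∣))))))
  splits-length (false ∷ S) t (suc u) = begin
    length (map (true ∷_) (splits S t u) ++ map (false ∷_) (splits S t (suc u)))
      ≡⟨ Listₚ.length-++ (map (true ∷_) (splits S t u)) ⟩
    length (map (true ∷_) (splits S t u)) + length (map (false ∷_) (splits S t (suc u)))
      ≡⟨ cong₂ _+_ (Listₚ.length-map _ (splits S t u)) (Listₚ.length-map _ (splits S t (suc u))) ⟩
    length (splits S t u) + length (splits S t (suc u))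
      ≡⟨ cong₂ _+_ (splits-length S t u) (splits-length S t (suc u)) ⟩
    (∣ S ∣ C t) * (∣ ∁ S ∣ C u) + (∣ S ∣ C t) * (∣ ∁ S ∣ C suc u)
      ≡⟨ *-distribˡ-+ (∣ S ∣ C t) (∣ ∁ S ∣ C u) (∣ ∁ S ∣ C suc u) ⟨
    (∣ S ∣ C t) * (∣ ∁ S ∣ C u + ∣ ∁ S ∣ C suc u)
      ≡⟨ cong ((∣ S ∣ C t) *_) (nCk+nC[k+1]≡[n+1]C[k+1] ∣ ∁ S ∣ u) ⟩
    (∣ S ∣ C t) * (suc ∣ ∁ S ∣ C suc u) ∎
    where open ≡-Reasoning

  record Splits (S : Subset n) (t u : ℕ) (e : Subset n) : Set where
    constructor mkSplits
    field
      within  : sumOver S (incidence e) ≡ t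
      without : sumOver (∁ S) (incidence e) ≡ u
      size    : ∣ e ∣ ≡ t + u

  open Splits

  splits-sound : (S : Subset n) (t u : ℕ) → All (Splits S t u) (splits S t u)
  splits-sound [] zero zero = mkSplits refl refl refl ∷ []
  splits-sound [] zero (suc u) = []
  splits-sound [] (suc t) u = []
  splits-sound (true ∷ S) zero u = Allₚ.map⁺ (All.map (λ (mkSplits p q r) → mkSplits p q r) (splits-sound S zero u))
  splits-sound (true ∷ S) (suc t) u = Allₚ.++⁺
    (Allₚ.map⁺ (All.map (λ (mkSplits p q r) → mkSplits (cong suc p) q (cong suc r)) (splits-sound S t u)))
    (Allₚ.map⁺ (All.map (λ (mkSplits p q r) → mkSplits p q r) (splits-sound S (suc t) u)))
  splits-sound (false ∷ S) t zero = Allₚ.map⁺ (All.map (λ (mkSplits p q r) → mkSplits p q r) (splits-sound S t zero))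
  splits-sound (false ∷ S) t (suc u) = Allₚ.++⁺
    (Allₚ.map⁺ (All.map (λ (mkSplits p q r) → mkSplits p (cong suc q) (trans (cong suc r) (sym (+-suc t u))))
      (splits-sound S t u)))
    (Allₚ.map⁺ (All.map (λ (mkSplits p q r) → mkSplits p q r) (splits-sound S t (suc u))))

  splits-unique : (S : Subset n) (t u : ℕ) → Unique (splits S t u)
  splits-unique = go
    where
    prefixed : ∀ {m} (b : Bool) {es : List (Subset m)} → Unique es → Unique (map (b ∷_) es)
    prefixed b = Uniqueₚ.map⁺ Vecₚ.∷-injectiveʳ
    apart : ∀ {m} {es fs : List (Subset m)} → Disjoint (map (true ∷_) es) (map (false ∷_) fs)
    apart (p , q) with ∈-map⁻ _ p | ∈-map⁻ _ q
    ... | _ , _ , refl | _ , _ , ()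
    go : ∀ {m} (S : Subset m) t u → Unique (splits S t u)
    go [] zero zero = [] ∷ []
    go [] zero (suc u) = []
    go [] (suc t) u = []
    go (true ∷ S) zero u = prefixed false (go S zero u)
    go (true ∷ S) (suc t) u = Uniqueₚ.++⁺ (prefixed true (go S t u)) (prefixed false (go S (suc t) u)) apart
    go (false ∷ S) t zero = prefixed false (go S t zero)
    go (false ∷ S) t (suc u) = Uniqueₚ.++⁺ (prefixed true (go S t u)) (prefixed false (go S t (suc u))) apart

  sumOver-+ : (S : Subset n) (d d′ : Fin n → ℕ) → sumOver S (λ v → d v + d′ v) ≡ sumOver S d + sumOver S d′
  sumOver-+ S d d′ = trans
    (sum-cong-≗ {y = λ v → incidence S v * d v + incidence S v * d′ v} λ v → *-distribˡ-+ (incidence S v) (d v) (d′ v))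
    (∑-distrib-+ (λ v → incidence S v * d v) (λ v → incidence S v * d′ v))

  sumOver-deg-++ : (S : Subset n) (es fs : List (Subset n)) →
    sumOver S (deg (es ++ fs)) ≡ sumOver S (deg es) + sumOver S (deg fs)
  sumOver-deg-++ S es fs = trans
    (sum-cong-≗ {y = λ v → incidence S v * (deg es v + deg fs v)} λ v → cong (incidence S v *_) (deg-++ es fs v))
    (sumOver-+ S (deg es) (deg fs))

  sumOver-deg : (S : Subset n) {t : ℕ} {es : List (Subset n)} →
    All (λ e → sumOver S (incidence e) ≡ t) es → sumOver S (deg es) ≡ length es * t
  sumOver-deg S [] = trans (sumOver-const S 0) (*-zeroʳ ∣ S ∣)
  sumOver-deg S {es = e ∷ es} (p ∷ ps) = trans (sumOver-+ S (incidence e) (deg es)) (cong₂ _+_ p (sumOver-deg S ps))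

  ∑-splits : (S : Subset n) (d : Fin n → ℕ) → ∑ d ≡ sumOver S d + sumOver (∁ S) d
  ∑-splits S d = trans (sum-cong-≗ {y = λ v → incidence S v * d v + incidence (∁ S) v * d v} pointwise)
    (∑-distrib-+ (λ v → incidence S v * d v) (λ v → incidence (∁ S) v * d v))
    where
    pointwise : ∀ v → d v ≡ incidence S v * d v + incidence (∁ S) v * d v
    pointwise v rewrite Vecₚ.lookup-map v not S with lookup S v
    ... | true  = sym (trans (+-identityʳ _) (*-identityˡ (d v)))
    ... | false = sym (*-identityˡ (d v))

  handshake : (es : List (Subset n)) → All (λ e → ∣ e ∣ ≡ 3) es → ∑ (deg es) ≡ length es * 3
  handshake {n} [] [] = sum-replicate-zero n
  handshake (e ∷ es) (p ∷ ps) = trans (∑-distrib-+ (incidence e) (deg es))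
    (cong₂ _+_ (trans (sym (∣∣≡∑ e)) p) (handshake es ps))

  layer : Subset n → ℕ → ℕ → ℕ → List (Subset n)
  layer S x t u = take x (splits S t u)

  layer-sound : (S : Subset n) (x t u : ℕ) → All (Splits S t u) (layer S x t u)
  layer-sound S x t u = Allₚ.take⁺ x (splits-sound S t u)

  layer-length : (S : Subset n) {x : ℕ} (t u : ℕ) → x ≤ (∣ S ∣ C t) * (∣ ∁ S ∣ C u) → length (layer S x t u) ≡ x
  layer-length S {x} t u le = trans (Listₚ.length-take x (splits S t u))
    (m≤n⇒m⊓n≡m (subst (x ≤_) (sym (splits-length S t u)) le))

  layer-disjoint : (S : Subset n) {x y t t′ u u′ : ℕ} → t ≢ t′ → Disjoint (layer S x t u) (layer S y t′ u′)
  layer-disjoint S {x} {y} {t} {t′} {u} {u′} t≢t′ (p , q) =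
    t≢t′ (trans (sym (within (All.lookup (layer-sound S x t u) p))) (within (All.lookup (layer-sound S y t′ u′) q)))

  module _ (S : Subset n) {x₃ x₂ x₁ x₀ : ℕ}
    (x₃≤ : x₃ ≤ (∣ S ∣ C 3) * (∣ ∁ S ∣ C 0)) (x₂≤ : x₂ ≤ (∣ S ∣ C 2) * (∣ ∁ S ∣ C 1))
    (x₁≤ : x₁ ≤ (∣ S ∣ C 1) * (∣ ∁ S ∣ C 2)) (x₀≤ : x₀ ≤ (∣ S ∣ C 0) * (∣ ∁ S ∣ C 3)) where

    private
      l₃ = layer S x₃ 3 0
      l₂ = layer S x₂ 2 1
      l₁ = layer S x₁ 1 2
      l₀ = layer S x₀ 0 3

    -- The four counts are independent of each other here; `greedy` is what fills one layer before
    -- opening the next.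
    layered : List (Subset n)
    layered = concat (l₃ ∷ l₂ ∷ l₁ ∷ l₀ ∷ [])

    layered-simple : Simple3 layered
    layered-simple =
      Uniqueₚ.concat⁺
        (uniq x₃ 3 0 ∷ uniq x₂ 2 1 ∷ uniq x₁ 1 2 ∷ uniq x₀ 0 3 ∷ [])
        ((layer-disjoint S (λ ()) ∷ layer-disjoint S (λ ()) ∷ layer-disjoint S (λ ()) ∷ [])
          ∷ (layer-disjoint S (λ ()) ∷ layer-disjoint S (λ ()) ∷ [])
          ∷ (layer-disjoint S (λ ()) ∷ []) ∷ [] ∷ []) ,
      Allₚ.concat⁺ (All.map size (layer-sound S x₃ 3 0) ∷ All.map size (layer-sound S x₂ 2 1)
        ∷ All.map size (layer-sound S x₁ 1 2) ∷ All.map size (layer-sound S x₀ 0 3) ∷ [])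
      where
      uniq : ∀ x t u → Unique (layer S x t u)
      uniq x t u = Uniqueₚ.take⁺ x (splits-unique S t u)

    private
      weigh : (T : Subset n) {t₃ t₂ t₁ t₀ : ℕ} →
        All (λ e → sumOver T (incidence e) ≡ t₃) l₃ → All (λ e → sumOver T (incidence e) ≡ t₂) l₂ →
        All (λ e → sumOver T (incidence e) ≡ t₁) l₁ → All (λ e → sumOver T (incidence e) ≡ t₀) l₀ →
        sumOver T (deg layered) ≡ x₃ * t₃ + (x₂ * t₂ + (x₁ * t₁ + (x₀ * t₀ + 0)))
      weigh T a₃ a₂ a₁ a₀ = part (layer-length S 3 0 x₃≤) a₃ (part (layer-length S 2 1 x₂≤) a₂
        (part (layer-length S 1 2 x₁≤) a₁ (part (layer-length S 0 3 x₀≤) a₀ (sumOver-deg T {t = 0} []))))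
        where
        part : ∀ {x t r} {es fs : List (Subset n)} → length es ≡ x → All (λ e → sumOver T (incidence e) ≡ t) es →
          sumOver T (deg fs) ≡ r → sumOver T (deg (es ++ fs)) ≡ x * t + r
        part {t = t} {es = es} {fs} len a rest = trans (sumOver-deg-++ T es fs)
          (cong₂ _+_ (trans (sumOver-deg T a) (cong (_* t) len)) rest)

    layered-within : sumOver S (deg layered) ≡ x₃ * 3 + x₂ * 2 + x₁
    layered-within = trans
      (weigh S (All.map within (layer-sound S x₃ 3 0)) (All.map within (layer-sound S x₂ 2 1))
        (All.map within (layer-sound S x₁ 1 2)) (All.map within (layer-sound S x₀ 0 3)))
      (collect x₃ x₂ x₁ x₀)
      where
      collect : ∀ x₃ x₂ x₁ x₀ → x₃ * 3 + (x₂ * 2 + (x₁ * 1 + (x₀ * 0 + 0))) ≡ x₃ * 3 + x₂ * 2 + x₁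
      collect = solve-∀

    layered-without : sumOver (∁ S) (deg layered) ≡ x₂ + x₁ * 2 + x₀ * 3
    layered-without = trans
      (weigh (∁ S) (All.map without (layer-sound S x₃ 3 0)) (All.map without (layer-sound S x₂ 2 1))
        (All.map without (layer-sound S x₁ 1 2)) (All.map without (layer-sound S x₀ 0 3)))
      (collect x₃ x₂ x₁ x₀)
      where
      collect : ∀ x₃ x₂ x₁ x₀ → x₃ * 0 + (x₂ * 1 + (x₁ * 2 + (x₀ * 3 + 0))) ≡ x₂ + x₁ * 2 + x₀ * 3
      collect = solve-∀

  ∣∁∣ : (S : Subset n) {j : ℕ} → ∣ S ∣ + j ≡ n → ∣ ∁ S ∣ ≡ j
  ∣∁∣ S {j} eq = trans (∣∁p∣≡n∸∣p∣ S) (trans (cong (_∸ ∣ S ∣) (sym eq)) (m+n∸m≡n ∣ S ∣ j))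

  -- Sets of vertices of largest degree, and extreme degrees

  TopSet : (Fin n → ℕ) → Subset n → Set
  TopSet D S = ∀ i j → lookup S i ≡ true → lookup S j ≡ false → D j ≤ D i

  ∣insert∣ : (S : Subset n) (v : Fin n) → lookup S v ≡ false → ∣ S [ v ]≔ true ∣ ≡ suc ∣ S ∣
  ∣insert∣ (false ∷ S) zero refl = refl
  ∣insert∣ (true ∷ S) (suc v) v∉S = cong suc (∣insert∣ S v v∉S)
  ∣insert∣ (false ∷ S) (suc v) v∉S = ∣insert∣ S v v∉S

  missing : (S : Subset n) → ∣ S ∣ < n → ∃[ v ] lookup S v ≡ false
  missing (false ∷ S) _ = zero , refl
  missing (true ∷ S) (s≤s lt) with missing S lt
  ... | v , v∉S = suc v , v∉S

  argmax-outside : (D : Fin n → ℕ) (S : Subset n) → ∣ S ∣ < n →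
    ∃[ v ] lookup S v ≡ false × (∀ j → lookup S j ≡ false → D j ≤ D v)
  argmax-outside {n} D S lt with missing S lt
  ... | v₀ , v₀∉S = argmax D v₀ outsiders ,
      argmax-all D v₀∉S (All.tabulate {xs = outsiders} λ p → proj₂ (∈-filter⁻ outside? {xs = allFin n} p)) ,
      λ j j∉S → All.lookup (f[xs]≤f[argmax] v₀ outsiders) (∈-filter⁺ outside? {xs = allFin n} (∈-allFin j) j∉S)
    where
    outside? : ∀ v → _
    outside? v = lookup S v Boolₚ.≟ false
    outsiders : List (Fin n)
    outsiders = filter outside? (allFin n)

  topSet : (D : Fin n → ℕ) (k : ℕ) → k ≤ n → ∃[ S ] ∣ S ∣ ≡ k × TopSet D S
  topSet {n} D zero _ = ∅ , ∣⊥∣≡0 n , λ i _ i∈S _ → contradiction (trans (sym i∈S) (Vecₚ.lookup-replicate i false)) λ ()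
  topSet {n} D (suc k) k<n with topSet D k (<⇒≤ k<n)
  ... | S , refl , top with argmax-outside D S k<n
  ...   | v , v∉S , max = S [ v ]≔ true , ∣insert∣ S v v∉S , top′
    where
    top′ : TopSet D (S [ v ]≔ true)
    top′ i j i∈ j∉ with i ≟ v | j ≟ v
    ... | _ | yes refl = contradiction (trans (sym (Vecₚ.lookup∘updateAt j S)) j∉) λ ()
    ... | yes refl | no j≢v = max j (trans (sym (Vecₚ.lookup∘update′ j≢v S true)) j∉)
    ... | no i≢v | no j≢v = top i j (trans (sym (Vecₚ.lookup∘update′ i≢v S true)) i∈)
                                    (trans (sym (Vecₚ.lookup∘update′ j≢v S true)) j∉)

  extremes : 0 < n → (f : Fin n → ℕ) → ∃[ i ] ∃[ j ] (∀ v → f i ≤ f v) × (∀ v → f v ≤ f j)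
  extremes {suc n} _ f = argmin f zero (allFin (suc n)) , argmax f zero (allFin (suc n)) ,
    (λ v → All.lookup (f[argmin]≤f[xs] {f = f} zero (allFin (suc n))) (∈-allFin v)) ,
    (λ v → All.lookup (f[xs]≤f[argmax] {f = f} zero (allFin (suc n))) (∈-allFin v))

  ∑-≥ : {a : ℕ} (f : Fin n → ℕ) → (∀ v → a ≤ f v) → n * a ≤ ∑ f
  ∑-≥ {zero}  f a≤f = z≤n
  ∑-≥ {suc n} f a≤f = +-mono-≤ (a≤f zero) (∑-≥ (f ∘ suc) (a≤f ∘ suc))

  ∑-≤ : {b : ℕ} (f : Fin n → ℕ) → (∀ v → f v ≤ b) → ∑ f ≤ n * b
  ∑-≤ {zero}  f f≤b = z≤n
  ∑-≤ {suc n} f f≤b = +-mono-≤ (f≤b zero) (∑-≤ (f ∘ suc) (f≤b ∘ suc))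

  sum≡∑ : (D : Vec ℕ n) → sumᵥ D ≡ ∑ (lookup D)
  sum≡∑ []      = refl
  sum≡∑ (d ∷ D) = cong (d +_) (sum≡∑ D)

  -- The numerical residue of the realization problem: `xₜ` edges with t vertices in a set of `K`
  -- vertices, and `T` the sum of all degrees. The two sums in `total` are those over the set and
  -- over its complement; `heavy` and `light` are the left alternatives of `Heavy` and `Light`.
  record Allocation (n a b T : ℕ) : Set where
    field
      {K j}         : ℕ
      {x₃ x₂ x₁ x₀} : ℕ
      K+j≡n : K + j ≡ n
      x₃≤ : x₃ ≤ K C 3
      x₂≤ : x₂ ≤ (K C 2) * j
      x₁≤ : x₁ ≤ K * (j C 2)
      x₀≤ : x₀ ≤ j C 3
      total : (x₃ * 3 + x₂ * 2 + x₁) + (x₂ + x₁ * 2 + x₀ * 3) ≡ T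
      heavy : K * b ≤ x₃ * 3 + x₂ * 2 + x₁
      light : x₂ + x₁ * 2 + x₀ * 3 ≤ j * a

  realize : (D : Fin n → ℕ) {a b : ℕ} → (∀ v → a ≤ D v) → (∀ v → D v ≤ b) →
    Allocation n a b (∑ D) → ∃[ es ] Simple3 es × (∀ v → deg es v ≡ D v)
  realize D {a} {b} a≤D D≤b A with topSet D (Allocation.K A) (m+n≤o⇒m≤o _ (≤-reflexive (Allocation.K+j≡n A)))
  -- The fuel is fixed by `≤-refl` below to one more than the initial excess.
  ... | S , refl , top = Levelling.level S D a≤D D≤b top _ edges
      (layered-simple S c₃ c₂ c₁ c₀) ≤-refl
      (trans (∑-splits S (deg edges)) (trans (cong₂ _+_ in-S out-S) total))
      (inj₁ (subst (∣ S ∣ * b ≤_) (sym in-S) heavy))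
      (inj₁ (subst₂ _≤_ (sym out-S) (cong (_* a) (sym ∣∁S∣≡j)) light))
    where
    open Allocation A
    ∣∁S∣≡j = ∣∁∣ S K+j≡n
    c₃ : x₃ ≤ (∣ S ∣ C 3) * (∣ ∁ S ∣ C 0)
    c₃ = subst (x₃ ≤_) (sym (trans (cong ((∣ S ∣ C 3) *_) (nC0≡1 ∣ ∁ S ∣)) (*-identityʳ (∣ S ∣ C 3)))) x₃≤
    c₂ : x₂ ≤ (∣ S ∣ C 2) * (∣ ∁ S ∣ C 1)
    c₂ = subst (x₂ ≤_) (cong ((∣ S ∣ C 2) *_) (sym (trans (cong (_C 1) ∣∁S∣≡j) (nC1≡n j)))) x₂≤
    c₁ : x₁ ≤ (∣ S ∣ C 1) * (∣ ∁ S ∣ C 2)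
    c₁ = subst (x₁ ≤_) (sym (cong₂ _*_ (nC1≡n ∣ S ∣) (cong (_C 2) ∣∁S∣≡j))) x₁≤
    c₀ : x₀ ≤ (∣ S ∣ C 0) * (∣ ∁ S ∣ C 3)
    c₀ = subst (x₀ ≤_) (sym (trans (cong₂ _*_ (nC0≡1 ∣ S ∣) (cong (_C 3) ∣∁S∣≡j)) (*-identityˡ (j C 3)))) x₀≤
    edges = layered S c₃ c₂ c₁ c₀
    in-S = layered-within S c₃ c₂ c₁ c₀
    out-S = layered-without S c₃ c₂ c₁ c₀

  -- Choosing the subset and the numbers of edges

  -- Polynomial inequalities below are certified by a ring identity with an explicit slack s.
  ≤-by : ∀ {l r} s {x y} → l ≤ r → y + l ≡ x + r + s → x ≤ y
  ≤-by {l} {r} s {x} {y} l≤r eq = +-cancelʳ-≤ r x y (≤-trans (m≤m+n (x + r) s)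
    (≤-trans (≤-reflexive (sym eq)) (+-monoʳ-≤ y l≤r)))

  absurd-by : ∀ {l r} s → 0 < s → l ≤ r → l ≡ r + s → ⊥
  absurd-by {r = r} s 0<s l≤r refl = <⇒≱ 0<s (+-cancelˡ-≤ r s 0 (≤-trans l≤r (≤-reflexive (sym (+-identityʳ r)))))

  nC2 : ∀ n → 2 * (n C 2) + n ≡ n * n
  nC2 zero    = refl
  nC2 (suc n) = begin
    2 * (suc n C 2) + suc n       ≡⟨ cong (λ c → 2 * c + suc n) (nCk+nC[k+1]≡[n+1]C[k+1] n 1) ⟨
    2 * (n C 1 + n C 2) + suc n   ≡⟨ cong (λ c → 2 * (c + n C 2) + suc n) (nC1≡n n) ⟩
    2 * (n + n C 2) + suc n       ≡⟨ gather n (n C 2) ⟩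
    (2 * (n C 2) + n) + (2 * n + 1)  ≡⟨ cong (_+ (2 * n + 1)) (nC2 n) ⟩
    n * n + (2 * n + 1)           ≡⟨ square n ⟩
    suc n * suc n                 ∎
    where
    open ≡-Reasoning
    gather : ∀ n c → 2 * (n + c) + suc n ≡ (2 * c + n) + (2 * n + 1)
    gather = solve-∀
    square : ∀ n → n * n + (2 * n + 1) ≡ suc n * suc n
    square = solve-∀

  nC3 : ∀ n → 6 * (n C 3) + 3 * (n * n) ≡ n * n * n + 2 * n
  nC3 zero    = refl
  nC3 (suc n) = begin
    6 * (suc n C 3) + 3 * (suc n * suc n)
      ≡⟨ cong (λ c → 6 * c + 3 * (suc n * suc n)) (nCk+nC[k+1]≡[n+1]C[k+1] n 2) ⟨
    6 * (n C 2 + n C 3) + 3 * (suc n * suc n)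
      ≡⟨ gather n (n C 2) (n C 3) ⟩
    3 * (2 * (n C 2) + n) + (6 * (n C 3) + 3 * (n * n)) + (3 * n + 3)
      ≡⟨ cong₂ (λ x y → 3 * x + y + (3 * n + 3)) (nC2 n) (nC3 n) ⟩
    3 * (n * n) + (n * n * n + 2 * n) + (3 * n + 3)
      ≡⟨ cube n ⟩
    suc n * suc n * suc n + 2 * suc n ∎
    where
    open ≡-Reasoning
    gather : ∀ n c d → 6 * (c + d) + 3 * (suc n * suc n) ≡ 3 * (2 * c + n) + (6 * d + 3 * (n * n)) + (3 * n + 3)
    gather = solve-∀
    cube : ∀ n → 3 * (n * n) + (n * n * n + 2 * n) + (3 * n + 3) ≡ suc n * suc n * suc n + 2 * suc n
    cube = solve-∀

  -- The regimes of C(α, c₂/2) at α = p/(p+j), with denominators cleared and 1/u ≤ c₁ − c₁*.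
  record Dense (u N a b : ℕ) : Set where
    field
      mid  : ∀ p j → 0 < p → 0 < j → let q = p + j in
        p * u * (q * q) * b + 2 * j * (q * q) * N ≤ 2 * j * (q * q) * a * u + u * (p * p * p) * N
      high : ∀ p j → 0 < p → 0 < j → let q = p + j in
        4 * p * u * (q * q) * b + 2 * j * (q * q) * N
          ≤ 2 * j * (q * q) * a * u + 4 * (p * p * p) * N * u + 6 * (p * p) * j * N * u

  -- The middle formula is at least -α³/(2(1 - α)), negligible for small α. At α = 1/(2u), that is p
  -- = 1 and q = 2u, the surplus 1/u survives with at least half its size.
  dense-lower : ∀ {u N a b} → 2 ≤ u → Dense u N a b → N ≤ 2 * u * a
  dense-lower {u@(suc w)} {N} {a} {b} _ dense = *-cancelˡ-≤ (4 * suc (2 * w) * (u * u))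
    (≤-by (4 * (u * u * u) * b + u * (8 * (w * w) + 12 * w + 3) * N)
      (Dense.mid dense 1 (suc (2 * w)) (s≤s z≤n) (s≤s z≤n)) (identity w N a b))
    where
    identity : ∀ w N a b → let u = suc w; j = suc (2 * w); q = 1 + j in
      4 * j * (u * u) * (2 * u * a) + (1 * u * (q * q) * b + 2 * j * (q * q) * N) ≡
      4 * j * (u * u) * N + (2 * j * (q * q) * a * u + u * (1 * 1 * 1) * N) +
      (4 * (u * u * u) * b + u * (8 * (w * w) + 12 * w + 3) * N)
    identity = solve-∀

  -- The factor α/(1 - α) blows up as α tends to 1, so c₂ near 1 would force C above c₂ ≥ c₁. Taken
  -- at α = 1 - 1/(2u), that is p = 2u - 1 and j = 1, with `a` replaced by `b`. Then `b` keeps a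
  -- factor proportional to p - 2, positive because u ≥ 2, and b ≤ (1 - 1/(4u²)) N results.
  dense-upper : ∀ {u N a b} → 2 ≤ u → a ≤ b → Dense u N a b → 4 * (u * u) * b + N ≤ 4 * (u * u) * N
  dense-upper {u@(suc (suc y))} {N} {a} {b} _ a≤b dense = *-cancelˡ-≤ (u * suc (2 * y))
    (≤-by (4 * u * N)
      (+-mono-≤ (Dense.mid dense p 1 (s≤s z≤n) (s≤s z≤n)) (*-monoʳ-≤ (2 * ((p + 1) * (p + 1)) * u) a≤b))
      (identity y N a b))
    where
    p = suc (2 * suc y)
    identity : ∀ y N a b → let u = suc (suc y); p = suc (2 * suc y); q = p + 1 in
      u * suc (2 * y) * (4 * (u * u) * N) +
        ((p * u * (q * q) * b + 2 * 1 * (q * q) * N) + 2 * (q * q) * u * a) ≡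
      u * suc (2 * y) * (4 * (u * u) * b + N) +
        ((2 * 1 * (q * q) * a * u + u * (p * p * p) * N) + 2 * (q * q) * u * b) + 4 * u * N
    identity = solve-∀
  dense-upper {suc zero} (s≤s ()) _ _

  -- `N` is C(n-1, 2), the number of triples through a vertex, described by `N≡` without division or
  -- subtraction. `M` is the number of edges to be placed, so `M * 3` is the degree sum.
  module Counting {n u N a b M : ℕ} (2≤u : 2 ≤ u) (n-large : 336 * (u * u * u) ≤ n)
    (N≡ : 2 * N + 3 * n ≡ n * n + 2) (a≤b : a ≤ b) (dense : Dense u N a b)
    (lower : n * a ≤ M * 3) (upper : M * 3 ≤ n * b) where

    private
      0<u : 0 < u
      0<u = <-≤-trans (s≤s z≤n) 2≤u

      1≤uu : 1 ≤ u * u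
      1≤uu = *-mono-≤ 0<u 0<u

      u≤uuu : u ≤ u * u * u
      u≤uuu = ≤-trans (≤-reflexive (sym (*-identityˡ u))) (*-monoˡ-≤ u 1≤uu)

      6≤n : 6 ≤ n
      6≤n = ≤-trans (m≤m+n 6 330) (≤-trans (*-monoʳ-≤ 336 (≤-trans 0<u u≤uuu)) n-large)

      0<n : 0 < n
      0<n = ≤-trans (s≤s z≤n) 6≤n

      0<unn : 0 < u * (n * n)
      0<unn = *-mono-≤ 0<u (*-mono-≤ 0<n 0<n)

      2N≤n² : 2 * N ≤ n * n
      2N≤n² = ≤-by 0 (+-mono-≤ (≤-reflexive N≡) 2≤3n) (identity N n)
        where
        2≤3n : 2 ≤ 3 * n
        2≤3n = ≤-trans (s≤s (s≤s z≤n)) (*-monoʳ-≤ 3 0<n)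
        identity : ∀ N n → n * n + ((2 * N + 3 * n) + 2) ≡ 2 * N + ((n * n + 2) + 3 * n) + 0
        identity = solve-∀

      n²≤4N : n * n ≤ 4 * N
      n²≤4N = ≤-by 4 (+-mono-≤ (*-monoʳ-≤ 2 (≤-reflexive (sym N≡))) (*-monoˡ-≤ n 6≤n)) (identity N n)
        where
        identity : ∀ N n → 4 * N + (2 * (n * n + 2) + 6 * n) ≡ n * n + (2 * (2 * N + 3 * n) + n * n) + 4
        identity = solve-∀

      b≤N : b ≤ N
      b≤N = *-cancelˡ-≤ (4 * (u * u)) {{>-nonZero (*-mono-≤ {1} {4} (s≤s z≤n) 1≤uu)}}
        (≤-trans (m≤m+n _ N) (dense-upper 2≤u a≤b dense))

      T≤nN : M * 3 ≤ n * N
      T≤nN = ≤-trans upper (*-monoʳ-≤ n b≤N)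

      dense-mid : ∀ {K j} → K + j ≡ n → 0 < K → 0 < j →
        K * u * (n * n) * b + 2 * j * (n * n) * N ≤ 2 * j * (n * n) * a * u + u * (K * K * K) * N
      dense-mid {K} {j} eq 0<K 0<j = subst (λ q → K * u * (q * q) * b + 2 * j * (q * q) * N ≤
        2 * j * (q * q) * a * u + u * (K * K * K) * N) eq (Dense.mid dense K j 0<K 0<j)

      dense-high : ∀ {K j} → K + j ≡ n → 0 < K → 0 < j →
        4 * K * u * (n * n) * b + 2 * j * (n * n) * N
          ≤ 2 * j * (n * n) * a * u + 4 * (K * K * K) * N * u + 6 * (K * K) * j * N * u
      dense-high {K} {j} eq 0<K 0<j = subst (λ q → 4 * K * u * (q * q) * b + 2 * j * (q * q) * N ≤
        2 * j * (q * q) * a * u + 4 * (K * K * K) * N * u + 6 * (K * K) * j * N * u) eq (Dense.high dense K j 0<K 0<j)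

      -- Leaving out J = n - K vertices costs about 3n²J of the n³ in 6 C(n, 3), while `dense-upper`
      -- saves about n³/(4u²) in 6M ≤ 2nb. Thus n ≥ 12u²J suffices to leading order; the extra 3
      -- covers the rest.
      M≤KC3 : ∀ {K J′} → K + suc J′ ≡ n → 12 * (u * u) * suc J′ + 3 ≤ n → M ≤ K C 3
      M≤KC3 {K} {J′} eq J-small = *-cancelˡ-≤ 6 (+-cancelʳ-≤ (3 * (K * K)) _ _
        (≤-trans (+-monoˡ-≤ (3 * (K * K)) 6M≤) (≤-trans
          (*-cancelˡ-≤ (4 * U) {{>-nonZero (*-mono-≤ {1} {4} (s≤s z≤n) 1≤uu)}} (bound n eq J-small N≡))
          (≤-reflexive (sym (nC3 K))))))
        where
        U = u * u
        6M≤ : 6 * M ≤ 2 * n * b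
        6M≤ = ≤-trans (≤-reflexive (double M)) (≤-trans (*-monoʳ-≤ 2 upper) (≤-reflexive (sym (*-assoc 2 n b))))
          where
          double : ∀ M → 6 * M ≡ 2 * (M * 3)
          double = solve-∀
        identity : ∀ U K J′ N b → let J = suc J′; n = K + J in
          4 * U * (K * K * K + 2 * K) +
            (2 * n * (4 * U * b + N) + n * n * (12 * U * J + 3) + 4 * U * n * (2 * N + 3 * n) + n * (n * n + 2)) ≡
          4 * U * (2 * n * b + 3 * (K * K)) +
            (2 * n * (4 * U * N) + n * n * n + 4 * U * n * (n * n + 2) + n * (2 * N + 3 * n)) +
            (2 * n + 4 * U * (3 * K * (J * J) + 2 * (J * J * J) + 6 * K * J + J * (3 * J′ + 1)))
        identity = solve-∀
        bound : ∀ n → K + suc J′ ≡ n → 12 * U * suc J′ + 3 ≤ n → 2 * N + 3 * n ≡ n * n + 2 →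
          4 * U * (2 * n * b + 3 * (K * K)) ≤ 4 * U * (K * K * K + 2 * K)
        bound n refl J-small N≡ = ≤-by _
          (+-mono-≤ (+-mono-≤ (+-mono-≤
            (*-monoʳ-≤ (2 * n) (dense-upper 2≤u a≤b dense))
            (*-monoʳ-≤ (n * n) J-small))
            (*-monoʳ-≤ (4 * U * n) (≤-reflexive N≡)))
            (*-monoʳ-≤ n (≤-reflexive (sym N≡))))
          (identity U K J′ N b)

      module _ {K j : ℕ} (K+j≡n : K + j ≡ n) (0<K : 0 < K) (j-large : 13 * u ≤ j) where

        private
          0<j : 0 < j
          0<j = ≤-trans (≤-trans 0<u (m≤m+n u (12 * u))) j-large

          K≤n : K ≤ n
          K≤n = ≤-trans (m≤m+n K j) (≤-reflexive K+j≡n)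

        -- Six times `short` plus four times `near` eliminates `x₂` and gives `H`, which clashes
        -- with `Dense.mid` at α = K/n. The main terms agree because 6 C(K, 3) is about K³ and 2N
        -- about n². What remains is 4jN/u against errors 3K² ≤ 12N and 4N, so j ≥ 4u is already
        -- contradictory.
        not-mid : ∀ {x₂} → suc ((K C 3) * 3 + x₂ * 2) ≤ K * b → K * b + j * a ≤ ((K C 3) + x₂) * 3 + N → ⊥
        not-mid {x₂} short near = absurd-by (u * (n * n) * (2 * K + 6))
          (*-mono-≤ 0<unn (≤-trans (s≤s z≤n) (m≤n+m 6 (2 * K))))
          (+-mono-≤ (+-mono-≤ (+-mono-≤ (+-mono-≤ (+-mono-≤
            (*-monoʳ-≤ 2 (dense-mid K+j≡n 0<K 0<j))
            (*-monoʳ-≤ (u * (n * n)) H))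
            (*-monoʳ-≤ (u * (K * K * K)) 2N≤n²))
            (*-monoʳ-≤ (3 * u * (n * n)) (≤-trans (*-mono-≤ K≤n K≤n) n²≤4N)))
            (*-monoʳ-≤ (4 * (n * n) * N) (≤-trans (*-monoˡ-≤ u (m≤m+n 4 9)) j-large)))
            (*-monoʳ-≤ (u * (n * n)) (≤-reflexive (sym (nC3 K)))))
          (identity u n N a b j K (K C 3))
          where
          collect : ∀ N a b j K C₃ x → 2 * K * b + 4 * N + (6 * suc (C₃ * 3 + x * 2) + 4 * (K * b + j * a)) ≡
            4 * j * a + 6 * C₃ + 6 + (6 * (K * b) + 4 * ((C₃ + x) * 3 + N)) + 0
          collect = solve-∀
          H : 4 * j * a + 6 * (K C 3) + 6 ≤ 2 * K * b + 4 * N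
          H = ≤-by 0 (+-mono-≤ (*-monoʳ-≤ 6 short) (*-monoʳ-≤ 4 near)) (collect N a b j K (K C 3) x₂)
          identity : ∀ u n N a b j K C₃ →
            2 * (K * u * (n * n) * b + 2 * j * (n * n) * N) + u * (n * n) * (4 * j * a + 6 * C₃ + 6)
              + u * (K * K * K) * (2 * N) + 3 * u * (n * n) * (K * K) + 4 * (n * n) * N * (4 * u)
              + u * (n * n) * (K * K * K + 2 * K) ≡
            2 * (2 * j * (n * n) * a * u + u * (K * K * K) * N) + u * (n * n) * (2 * K * b + 4 * N)
              + u * (K * K * K) * (n * n) + 3 * u * (n * n) * (4 * N) + 4 * (n * n) * N * j
              + u * (n * n) * (6 * C₃ + 3 * (K * K)) + u * (n * n) * (2 * K + 6)
          identity = solve-∀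

        -- As in `not-mid`, now with six times `short` plus twice `near` against `Dense.high`. The
        -- surplus 2jN/u meets the errors 6K² + 3Kj ≤ 24N and 2N; this total of 26N is the origin of
        -- the constant 13.
        not-high : ∀ {x₁} → suc ((K C 3) * 3 + (K C 2) * j * 2 + x₁) ≤ K * b →
          K * b + j * a ≤ ((K C 3) + (K C 2) * j + x₁) * 3 + N → ⊥
        not-high {x₁} short near = absurd-by (u * (n * n) * (4 * K + 6))
          (*-mono-≤ 0<unn (≤-trans (s≤s z≤n) (m≤n+m 6 (4 * K))))
          (+-mono-≤ (+-mono-≤ (+-mono-≤ (+-mono-≤ (+-mono-≤ (+-mono-≤ (+-mono-≤
            (dense-high K+j≡n 0<K 0<j)
            (*-monoʳ-≤ (u * (n * n)) H))
            (*-monoʳ-≤ (2 * u * (K * K * K)) 2N≤n²))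
            (*-monoʳ-≤ (3 * u * (K * K) * j) 2N≤n²))
            (*-monoʳ-≤ (2 * u * (n * n)) (≤-reflexive (sym (nC3 K)))))
            (*-monoʳ-≤ (3 * u * (n * n)) (≤-reflexive (cong (_* j) (sym (nC2 K))))))
            (*-monoʳ-≤ (u * (n * n)) square))
            (*-monoʳ-≤ (2 * (n * n) * N) j-large))
          (identity u n N a b j K (K C 2) (K C 3))
          where
          collect : ∀ N a b j K B C₃ x → 4 * K * b + 2 * N + (6 * suc (C₃ * 3 + B * 2 + x) + 2 * (K * b + j * a)) ≡
            2 * j * a + 12 * C₃ + 6 * B + 6 + (6 * (K * b) + 2 * ((C₃ + B + x) * 3 + N)) + 0
          collect = solve-∀
          H : 2 * j * a + 12 * (K C 3) + 6 * ((K C 2) * j) + 6 ≤ 4 * K * b + 2 * N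
          H = ≤-by 0 (+-mono-≤ (*-monoʳ-≤ 6 short) (*-monoʳ-≤ 2 near)) (collect N a b j K ((K C 2) * j) (K C 3) x₁)
          complete : ∀ K j → 6 * ((K + j) * (K + j)) ≡ 6 * (K * K) + 3 * K * j + (9 * K * j + 6 * (j * j))
          complete = solve-∀
          square : 6 * (K * K) + 3 * K * j ≤ 24 * N
          square = ≤-trans (m≤m+n _ (9 * K * j + 6 * (j * j))) (≤-trans (≤-reflexive (sym (complete K j)))
            (≤-trans (≤-reflexive (cong (λ m → 6 * (m * m)) K+j≡n)) (≤-trans (*-monoʳ-≤ 6 n²≤4N)
              (≤-reflexive (sym (*-assoc 6 4 N))))))
          identity : ∀ u n N a b j K C₂ C₃ →
            4 * K * u * (n * n) * b + 2 * j * (n * n) * N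
              + u * (n * n) * (2 * j * a + 12 * C₃ + 6 * (C₂ * j) + 6)
              + 2 * u * (K * K * K) * (2 * N) + 3 * u * (K * K) * j * (2 * N)
              + 2 * u * (n * n) * (K * K * K + 2 * K) + 3 * u * (n * n) * (K * K * j)
              + u * (n * n) * (6 * (K * K) + 3 * K * j) + 2 * (n * n) * N * (13 * u) ≡
            2 * j * (n * n) * a * u + 4 * (K * K * K) * N * u + 6 * (K * K) * j * N * u
              + u * (n * n) * (4 * K * b + 2 * N)
              + 2 * u * (K * K * K) * (n * n) + 3 * u * (K * K) * j * (n * n)
              + 2 * u * (n * n) * (6 * C₃ + 3 * (K * K)) + 3 * u * (n * n) * ((2 * C₂ + K) * j)
              + u * (n * n) * (24 * N) + 2 * (n * n) * N * j + u * (n * n) * (4 * K + 6)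
          identity = solve-∀

        -- Pays for the rounding of K when all edges fit inside S: `K * b + j * a ≤ M * 3 + b` and
        -- `b ≤ N ≤ j * a` yield `K * b ≤ M * 3`.
        N≤ja : N ≤ j * a
        N≤ja = ≤-trans (dense-lower 2≤u dense) (*-monoˡ-≤ a (≤-trans (*-monoˡ-≤ u (m≤m+n 2 11)) j-large))

      -- Once every triple meeting S is an edge, each vertex of S has degree `N`; the two sides are
      -- in fact equal.
      full-heavy : ∀ {K j} → K + j ≡ n → K * N ≤ (K C 3) * 3 + (K C 2) * j * 2 + K * (j C 2)
      full-heavy {K} {j} eq = *-cancelˡ-≤ 2 (go n eq N≡)
        where
        identity : ∀ N K j C₂ C₃ D → let n = K + j in
          2 * (C₃ * 3 + C₂ * j * 2 + K * D) +
            ((K * K * K + 2 * K) + 2 * j * (K * K) + K * (j * j) + K * (2 * N + 3 * n)) ≡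
          2 * (K * N) + ((6 * C₃ + 3 * (K * K)) + 2 * j * (2 * C₂ + K) + K * (2 * D + j) + K * (n * n + 2)) + 0
        identity = solve-∀
        go : ∀ n → K + j ≡ n → 2 * N + 3 * n ≡ n * n + 2 →
          2 * (K * N) ≤ 2 * ((K C 3) * 3 + (K C 2) * j * 2 + K * (j C 2))
        go n refl N≡ = ≤-by 0 (+-mono-≤ (+-mono-≤ (+-mono-≤
            (≤-reflexive (sym (nC3 K)))
            (*-monoʳ-≤ (2 * j) (≤-reflexive (sym (nC2 K)))))
            (*-monoʳ-≤ K (≤-reflexive (sym (nC2 j)))))
            (*-monoʳ-≤ K (≤-reflexive N≡)))
          (identity N K j (K C 2) (K C 3) (j C 2))

      -- By Vandermonde's identity the right side is C(n, 3), and 3M ≤ nN = 3 C(n, 3).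
      capacity : ∀ {K j} → K + j ≡ n → M ≤ (K C 3) + (K C 2) * j + K * (j C 2) + (j C 3)
      capacity {K} {j} eq = *-cancelˡ-≤ 6 (go n eq N≡ T≤nN)
        where
        identity : ∀ M N K j C₂ C₃ D E → let n = K + j in
          6 * (C₃ + C₂ * j + K * D + E) +
            (2 * (M * 3) + n * (2 * N + 3 * n) + (K * K * K + 2 * K) + (j * j * j + 2 * j)
              + 3 * j * (K * K) + 3 * K * (j * j)) ≡
          6 * M + (2 * (n * N) + n * (n * n + 2) + (6 * C₃ + 3 * (K * K)) + (6 * E + 3 * (j * j))
              + 3 * j * (2 * C₂ + K) + 3 * K * (2 * D + j)) + 0
        identity = solve-∀
        go : ∀ n → K + j ≡ n → 2 * N + 3 * n ≡ n * n + 2 → M * 3 ≤ n * N →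
          6 * M ≤ 6 * ((K C 3) + (K C 2) * j + K * (j C 2) + (j C 3))
        go n refl N≡ T≤nN = ≤-by 0 (+-mono-≤ (+-mono-≤ (+-mono-≤ (+-mono-≤ (+-mono-≤
            (*-monoʳ-≤ 2 T≤nN)
            (*-monoʳ-≤ n (≤-reflexive N≡)))
            (≤-reflexive (sym (nC3 K))))
            (≤-reflexive (sym (nC3 j))))
            (*-monoʳ-≤ (3 * j) (≤-reflexive (sym (nC2 K)))))
            (*-monoʳ-≤ (3 * K) (≤-reflexive (sym (nC2 j)))))
          (identity M N K j (K C 2) (K C 3) (j C 2) (j C 3))

      -- Because K was chosen so that `K * b + j * a` reaches the degree sum, `light` follows from
      -- `heavy`; only the sum over S needs an argument in `greedy`.
      remaining : ∀ {s r K j} → s + r ≡ M * 3 → M * 3 ≤ K * b + j * a → K * b ≤ s → r ≤ j * a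
      remaining {s} {r} {K} {j} eq T≤ Kb≤s = +-cancelˡ-≤ (K * b) r (j * a)
        (≤-trans (+-monoˡ-≤ r Kb≤s) (≤-trans (≤-reflexive eq) T≤))

      -- The first bound makes `heavy` imply `light`; the second, weakened by b ≤ N, is the
      -- hypothesis `near` that excludes a premature stop. The numbers `y₂`, `y₁`, `y₀` count the
      -- edges left over after each full layer.
      greedy : ∀ {K j} → K + j ≡ n → 0 < K → 13 * u ≤ j →
        M * 3 ≤ K * b + j * a → K * b + j * a ≤ M * 3 + b → Allocation n a b (M * 3)
      greedy {K} {j} K+j≡n 0<K j-large T≤ ≤T+b = inner
        where
        near : K * b + j * a ≤ M * 3 + N
        near = ≤-trans ≤T+b (+-monoʳ-≤ (M * 3) b≤N)

        inner : Allocation n a b (M * 3)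
        inner with M ≤? K C 3
        ... | yes M≤ = record { K = K ; j = j ; K+j≡n = K+j≡n ; x₃ = M ; x₂ = 0 ; x₁ = 0 ; x₀ = 0
            ; x₃≤ = M≤ ; x₂≤ = z≤n ; x₁≤ = z≤n ; x₀≤ = z≤n ; total = e M ; heavy = Kb≤ ; light = z≤n }
          where
          e : ∀ M → (M * 3 + 0 * 2 + 0) + (0 + 0 * 2 + 0 * 3) ≡ M * 3
          e = solve-∀
          e′ : ∀ M → M * 3 + 0 * 2 + 0 ≡ M * 3
          e′ = solve-∀
          Kb≤ : K * b ≤ M * 3 + 0 * 2 + 0
          Kb≤ = ≤-trans (+-cancelʳ-≤ b (K * b) (M * 3)
            (≤-trans (+-monoʳ-≤ (K * b) (≤-trans b≤N (N≤ja {K} {j} K+j≡n 0<K j-large))) ≤T+b))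
            (≤-reflexive (sym (e′ M)))
        ... | no M≰ with m≤n⇒∃[o]m+o≡n (<⇒≤ (≰⇒> M≰))
        ...   | y₂ , y₂≡ with y₂ ≤? (K C 2) * j
        ...     | yes y₂≤ = record { K = K ; j = j ; K+j≡n = K+j≡n ; x₃ = K C 3 ; x₂ = y₂ ; x₁ = 0 ; x₀ = 0
            ; x₃≤ = ≤-refl ; x₂≤ = y₂≤ ; x₁≤ = z≤n ; x₀≤ = z≤n ; total = tot ; heavy = hv
            ; light = remaining {K = K} {j} tot T≤ hv }
          where
          e : ∀ c y → (c * 3 + y * 2 + 0) + (y + 0 * 2 + 0 * 3) ≡ (c + y) * 3
          e = solve-∀
          tot : ((K C 3) * 3 + y₂ * 2 + 0) + (y₂ + 0 * 2 + 0 * 3) ≡ M * 3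
          tot = trans (e (K C 3) y₂) (cong (_* 3) y₂≡)
          hv : K * b ≤ (K C 3) * 3 + y₂ * 2 + 0
          hv = ≤-trans (≮⇒≥ λ lt → not-mid {K} {j} K+j≡n 0<K j-large {y₂} lt
            (subst (λ m → K * b + j * a ≤ m * 3 + N) (sym y₂≡) near)) (≤-reflexive (sym (+-identityʳ _)))
        ...     | no y₂≰ with m≤n⇒∃[o]m+o≡n (<⇒≤ (≰⇒> y₂≰))
        ...       | y₁ , y₁≡ with y₁ ≤? K * (j C 2)
        ...         | yes y₁≤ = record { K = K ; j = j ; K+j≡n = K+j≡n ; x₃ = K C 3 ; x₂ = (K C 2) * j ; x₁ = y₁ ; x₀ = 0
            ; x₃≤ = ≤-refl ; x₂≤ = ≤-refl ; x₁≤ = y₁≤ ; x₀≤ = z≤n ; total = tot ; heavy = hv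
            ; light = remaining {K = K} {j} tot T≤ hv }
          where
          M≡ : (K C 3) + (K C 2) * j + y₁ ≡ M
          M≡ = trans (+-assoc (K C 3) ((K C 2) * j) y₁) (trans (cong ((K C 3) +_) y₁≡) y₂≡)
          e : ∀ c d y → (c * 3 + d * 2 + y) + (d + y * 2 + 0 * 3) ≡ (c + d + y) * 3
          e = solve-∀
          tot : ((K C 3) * 3 + (K C 2) * j * 2 + y₁) + ((K C 2) * j + y₁ * 2 + 0 * 3) ≡ M * 3
          tot = trans (e (K C 3) ((K C 2) * j) y₁) (cong (_* 3) M≡)
          hv : K * b ≤ (K C 3) * 3 + (K C 2) * j * 2 + y₁
          hv = ≮⇒≥ λ lt → not-high {K} {j} K+j≡n 0<K j-large {y₁} lt
            (subst (λ m → K * b + j * a ≤ m * 3 + N) (sym M≡) near)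
        ...         | no y₁≰ with m≤n⇒∃[o]m+o≡n (<⇒≤ (≰⇒> y₁≰))
        ...           | y₀ , y₀≡ = record { K = K ; j = j ; K+j≡n = K+j≡n ; x₃ = K C 3 ; x₂ = (K C 2) * j
            ; x₁ = K * (j C 2) ; x₀ = y₀
            ; x₃≤ = ≤-refl ; x₂≤ = ≤-refl ; x₁≤ = ≤-refl
            ; x₀≤ = +-cancelˡ-≤ ((K C 3) + (K C 2) * j + K * (j C 2)) y₀ (j C 3)
                (≤-trans (≤-reflexive M≡) (capacity {K} {j} K+j≡n))
            ; total = tot ; heavy = hv ; light = remaining {K = K} {j} tot T≤ hv }
          where
          M≡ : (K C 3) + (K C 2) * j + K * (j C 2) + y₀ ≡ M
          M≡ = trans (+-assoc ((K C 3) + (K C 2) * j) (K * (j C 2)) y₀)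
            (trans (cong ((K C 3) + (K C 2) * j +_) y₀≡)
            (trans (+-assoc (K C 3) ((K C 2) * j) y₁) (trans (cong ((K C 3) +_) y₁≡) y₂≡)))
          e : ∀ c d f y → (c * 3 + d * 2 + f) + (d + f * 2 + y * 3) ≡ (c + d + f + y) * 3
          e = solve-∀
          tot : ((K C 3) * 3 + (K C 2) * j * 2 + K * (j C 2)) + ((K C 2) * j + K * (j C 2) * 2 + y₀ * 3) ≡ M * 3
          tot = trans (e (K C 3) ((K C 2) * j) (K * (j C 2)) y₀) (cong (_* 3) M≡)
          hv : K * b ≤ (K C 3) * 3 + (K C 2) * j * 2 + K * (j C 2)
          hv = ≤-trans (*-monoʳ-≤ K b≤N) (full-heavy {K} {j} K+j≡n)

      -- Lowers K while `K * b + j * a` still reaches the degree sum. When the next value fails, the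
      -- current one overshoots by at most b - a ≤ b, as `greedy` requires. If even K = 0 succeeds,
      -- the sum is at most n a and all edges are placed off the empty set.
      descend : ∀ K j → K + j ≡ n → 13 * u ≤ j → M * 3 ≤ K * b + j * a → Allocation n a b (M * 3)
      descend zero j refl _ T≤ = record { K = 0 ; j = j ; K+j≡n = refl ; x₃ = 0 ; x₂ = 0 ; x₁ = 0 ; x₀ = M
        ; x₃≤ = z≤n ; x₂≤ = z≤n ; x₁≤ = z≤n ; x₀≤ = capacity {0} {j} refl ; total = refl ; heavy = z≤n ; light = T≤ }
      descend (suc K) j eq j-large T≤ with M * 3 ≤? K * b + suc j * a
      ... | yes T≤′ = descend K (suc j) (trans (+-suc K j) eq) (m≤n⇒m≤1+n j-large) T≤′
      ... | no T≰ = greedy {suc K} {j} eq (s≤s z≤n) j-large T≤ (≤-by a (<⇒≤ (≰⇒> T≰)) (e M b K a j))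
        where
        e : ∀ M b K a j → M * 3 + b + (K * b + suc j * a) ≡ suc K * b + j * a + M * 3 + a
        e = solve-∀

    allocate : Allocation n a b (M * 3)
    allocate with m≤n⇒∃[o]m+o≡n {suc (13 * u)} {n} J≤n
      where
      J≤n : suc (13 * u) ≤ n
      J≤n = ≤-trans (+-mono-≤ (≤-trans 0<u u≤uuu) (*-monoʳ-≤ 13 u≤uuu))
        (≤-trans (*-monoˡ-≤ (u * u * u) (m≤m+n 14 322)) n-large)
    ... | K , eq with M * 3 ≤? K * b + suc (13 * u) * a
    ...   | yes T≤ = descend K (suc (13 * u)) K+J≡n (n≤1+n _) T≤
      where
      K+J≡n : K + suc (13 * u) ≡ n
      K+J≡n = trans (+-comm K _) eq
    -- Even with only 13u + 1 vertices left out, `K * b` plus the rest stays below the degree sum.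
    -- So `K * b` alone does too, and all edges may go inside S.
    ...   | no T≰ = record { K = K ; j = suc (13 * u) ; K+j≡n = K+J≡n ; x₃ = M ; x₂ = 0 ; x₁ = 0 ; x₀ = 0
        ; x₃≤ = M≤KC3 {K} K+J≡n J-small ; x₂≤ = z≤n ; x₁≤ = z≤n ; x₀≤ = z≤n ; total = e M
        ; heavy = ≤-trans (≤-trans (m≤m+n (K * b) _) (<⇒≤ (≰⇒> T≰))) (≤-reflexive (sym (e′ M))) ; light = z≤n }
      where
      K+J≡n : K + suc (13 * u) ≡ n
      K+J≡n = trans (+-comm K _) eq
      e : ∀ M → (M * 3 + 0 * 2 + 0) + (0 + 0 * 2 + 0 * 3) ≡ M * 3
      e = solve-∀
      e′ : ∀ M → M * 3 + 0 * 2 + 0 ≡ M * 3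
      e′ = solve-∀
      -- The left side is 156u³ + 12u² + 3, hence at most 171u³.
      J-small : 12 * (u * u) * suc (13 * u) + 3 ≤ n
      J-small = ≤-trans (≤-by 0 (+-mono-≤ (*-monoʳ-≤ 12 uu≤uuu) (*-monoʳ-≤ 3 (≤-trans 0<u u≤uuu))) (e″ u))
        (≤-trans (*-monoˡ-≤ (u * u * u) (m≤m+n 171 165)) n-large)
        where
        uu≤uuu : u * u ≤ u * u * u
        uu≤uuu = ≤-trans (≤-reflexive (sym (*-identityʳ (u * u)))) (*-monoʳ-≤ (u * u) 0<u)
        e″ : ∀ u → 171 * (u * u * u) + (12 * (u * u) + 3 * 1) ≡
          12 * (u * u) * suc (13 * u) + 3 + (12 * (u * u * u) + 3 * (u * u * u)) + 0
        e″ = solve-∀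

-- From rational approximations of c₁, c₂ and c₁* to the inequalities `Dense`

module Approximations where

  open import Data.Integer.Base as ℤ using (+_; +≤+)
  import Data.Integer.Properties as ℤₚ
  open import Data.Nat.Base as ℕ using (ℕ; zero; suc)
  import Data.Nat.Properties as ℕₚ
  open import Data.Product using (_×_; _,_; ∃-syntax)
  open import Data.Rational
  open import Data.Rational.Properties
  open import Data.Rational.Solver using (module +-*-Solver)
  import Data.Rational.Unnormalised.Base as ℚᵘ
  import Data.Rational.Unnormalised.Properties as ℚᵘₚ
  open import Defs using (invℚ)
  open import Relation.Binary.PropositionalEquality
  open import Relation.Nullary using (¬_; yes; no; contradiction)
  open import Relation.Nullary.Decidable using (decidable-stable)
  open +-*-Solver using (solve; con; _:=_; _:+_; _:*_; _:-_)
  open Combinatorics using (Dense)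

  ι : ℕ → ℚ
  ι n = + n / 1

  private
    toℚᵘ-ι : ∀ n → toℚᵘ (ι n) ℚᵘ.≃ ℚᵘ.mkℚᵘ (+ n) 0
    toℚᵘ-ι n = toℚᵘ-fromℚᵘ (ℚᵘ.mkℚᵘ (+ n) 0)

  ι-+ : ∀ m n → ι (m ℕ.+ n) ≡ ι m + ι n
  ι-+ m n = toℚᵘ-injective (ℚᵘₚ.≃-trans (toℚᵘ-ι (m ℕ.+ n)) (ℚᵘₚ.≃-trans
    (ℚᵘ.*≡* (cong (ℤ._* + 1) (trans (ℤₚ.pos-+ m n)
      (cong₂ ℤ._+_ (sym (ℤₚ.*-identityʳ (+ m))) (sym (ℤₚ.*-identityʳ (+ n)))))))
    (ℚᵘₚ.≃-sym (ℚᵘₚ.≃-trans (toℚᵘ-homo-+ (ι m) (ι n)) (ℚᵘₚ.+-cong (toℚᵘ-ι m) (toℚᵘ-ι n))))))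

  ι-* : ∀ m n → ι (m ℕ.* n) ≡ ι m * ι n
  ι-* m n = toℚᵘ-injective (ℚᵘₚ.≃-trans (toℚᵘ-ι (m ℕ.* n)) (ℚᵘₚ.≃-trans
    (ℚᵘ.*≡* (cong (ℤ._* + 1) (ℤₚ.pos-* m n)))
    (ℚᵘₚ.≃-sym (ℚᵘₚ.≃-trans (toℚᵘ-homo-* (ι m) (ι n)) (ℚᵘₚ.*-cong (toℚᵘ-ι m) (toℚᵘ-ι n))))))

  ι-cancel-≤ : ∀ {m n} → ι m ≤ ι n → m ℕ.≤ n
  ι-cancel-≤ {m} {n} le with ℚᵘₚ.≤-respʳ-≃ (toℚᵘ-ι n) (ℚᵘₚ.≤-respˡ-≃ (toℚᵘ-ι m) (toℚᵘ-mono-≤ le))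
  ... | ℚᵘ.*≤* p = ℤₚ.drop‿+≤+ (subst₂ ℤ._≤_ (ℤₚ.*-identityʳ (+ m)) (ℤₚ.*-identityʳ (+ n)) p)

  ι-mono-≤ : ∀ {m n} → m ℕ.≤ n → ι m ≤ ι n
  ι-mono-≤ {m} {n} le = toℚᵘ-cancel-≤ (ℚᵘₚ.≤-respʳ-≃ (ℚᵘₚ.≃-sym (toℚᵘ-ι n)) (ℚᵘₚ.≤-respˡ-≃ (ℚᵘₚ.≃-sym (toℚᵘ-ι m))
    (ℚᵘ.*≤* (subst₂ ℤ._≤_ (sym (ℤₚ.*-identityʳ (+ m))) (sym (ℤₚ.*-identityʳ (+ n))) (+≤+ le)))))

  0≤ι : ∀ n → 0ℚ ≤ ι n
  0≤ι n = ι-mono-≤ {0} {n} ℕ.z≤n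

  0<ι : ∀ {n} → 0 ℕ.< n → 0ℚ < ι n
  0<ι {suc n} _ = <-≤-trans (positive⁻¹ 1ℚ) (ι-mono-≤ {1} {suc n} (ℕ.s≤s ℕ.z≤n))

  infix  4 _↦_
  infixl 6 _⟨+⟩_
  infixl 7 _⟨*⟩_

  -- Transports a whole polynomial expression from ℕ to ℚ factor by factor. A factor may arrive in a
  -- different rational form, as p does in the shape α q.
  record _↦_ (n : ℕ) (x : ℚ) : Set where
    constructor ↦-by
    field
      image : ι n ≡ x

  open _↦_ public

  ⟪_⟫ : ∀ n → n ↦ ι n
  ⟪ n ⟫ = ↦-by refl

  _⟨+⟩_ : ∀ {m n x y} → m ↦ x → n ↦ y → (m ℕ.+ n) ↦ (x + y)
  _⟨+⟩_ {m} {n} (↦-by refl) (↦-by refl) = ↦-by (ι-+ m n)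

  _⟨*⟩_ : ∀ {m n x y} → m ↦ x → n ↦ y → (m ℕ.* n) ↦ (x * y)
  _⟨*⟩_ {m} {n} (↦-by refl) (↦-by refl) = ↦-by (ι-* m n)

  ↦-cancel-≤ : ∀ {m n x y} → m ↦ x → n ↦ y → x ≤ y → m ℕ.≤ n
  ↦-cancel-≤ {m} {n} (↦-by refl) (↦-by refl) = ι-cancel-≤ {m} {n}

  0≤-+ : ∀ {p q} → 0ℚ ≤ p → 0ℚ ≤ q → 0ℚ ≤ p + q
  0≤-+ {p} {q} 0≤p 0≤q = ≤-trans (≤-reflexive (sym (+-identityʳ 0ℚ))) (+-mono-≤ 0≤p 0≤q)

  0≤-* : ∀ {p q} → 0ℚ ≤ p → 0ℚ ≤ q → 0ℚ ≤ p * q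
  0≤-* {p} {q} 0≤p 0≤q = ≤-trans (≤-reflexive (sym (*-zeroʳ p))) (*-monoˡ-≤-nonNeg p {{nonNegative 0≤p}} 0≤q)

  0<-* : ∀ {p q} → 0ℚ < p → 0ℚ < q → 0ℚ < p * q
  0<-* {p} {q} 0<p 0<q = subst (_< p * q) (*-zeroʳ p) (*-monoʳ-<-pos p {{positive 0<p}} 0<q)

  ≤⇒0≤- : ∀ {p q} → p ≤ q → 0ℚ ≤ q - p
  ≤⇒0≤- {p} {q} p≤q = subst (_≤ q - p) (+-inverseʳ p) (+-monoˡ-≤ (- p) p≤q)

  <⇒0<- : ∀ {p q} → p < q → 0ℚ < q - p
  <⇒0<- {p} {q} p<q = subst (_< q - p) (+-inverseʳ p) (+-monoˡ-< (- p) p<q)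

  ≤-by : ∀ {x y} s → 0ℚ ≤ s → y ≡ x + s → x ≤ y
  ≤-by {x} s 0≤s refl = subst (_≤ x + s) (+-identityʳ x) (+-monoʳ-≤ x 0≤s)

  <⇒≱ : ∀ {p q} → p < q → ¬ q ≤ p
  <⇒≱ p<q q≤p = <-irrefl refl (<-≤-trans p<q q≤p)

  -- If x > y, the choice η = (x - y)/(2z) is refuted. The order on ℚ is decidable, so the double
  -- negation accumulated from case splits on reals disappears here.
  limit : ∀ {x y z} → 0ℚ < z → (∀ η → 0ℚ < η → ¬ ¬ (x ≤ y + η * z)) → x ≤ y
  limit {x} {y} {z} 0<z approx = decidable-stable (x ≤? y) λ x≰y →
    let 0<g = <⇒0<- (≰⇒> x≰y) in
    approx (½ * (x - y) * z⁻¹) (0<-* (0<-* (positive⁻¹ ½) 0<g) 0<z⁻¹) λ le →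
      <⇒≱ (0<-* (positive⁻¹ ½) 0<g) (+-cancel le)
    where
    instance
      _ = positive 0<z
      _ = pos⇒nonZero z
    z⁻¹ = 1/ z
    0<z⁻¹ = positive⁻¹ z⁻¹ {{1/pos⇒pos z}}
    unscale : ½ * (x - y) * z⁻¹ * z ≡ ½ * (x - y)
    unscale = trans (*-assoc (½ * (x - y)) z⁻¹ z) (trans (cong (½ * (x - y) *_) (*-inverseˡ z)) (*-identityʳ _))
    identity : ∀ x y → 0ℚ ≡ ½ * (x - y) + ((y + ½ * (x - y)) - x)
    identity = solve 2 (λ x y → con 0ℚ := con ½ :* (x :- y) :+ ((y :+ con ½ :* (x :- y)) :- x)) refl
    +-cancel : x ≤ y + ½ * (x - y) * z⁻¹ * z → ½ * (x - y) ≤ 0ℚ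
    +-cancel le = ≤-by _ (≤⇒0≤- (subst (λ t → x ≤ y + t) unscale le)) (identity x y)

  -- The denominator of `g` serves as `k`, the numerator being at least 1.
  archimedean : ∀ g → 0ℚ < g → ∃[ k ] 1ℚ ≤ ι k * g
  archimedean g@(mkℚ (+ suc p) d _) _ = suc d , toℚᵘ-cancel-≤ (ℚᵘₚ.≤-respʳ-≃
      (ℚᵘₚ.≃-sym (ℚᵘₚ.≃-trans (toℚᵘ-homo-* (ι (suc d)) g) (ℚᵘₚ.*-congʳ {toℚᵘ g} (toℚᵘ-ι (suc d)))))
      (ℚᵘ.*≤* (+≤+ (ℕₚ.≤-trans (ℕₚ.≤-reflexive eq) 
        (ℕₚ.≤-trans (ℕₚ.*-monoʳ-≤ (suc d) {1} {suc p} (ℕ.s≤s ℕ.z≤n))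
        (ℕₚ.≤-reflexive (sym (ℕₚ.*-identityʳ (suc d ℕ.* suc p)))))))))
    where
    eq : suc (d ℕ.+ 0 ℕ.+ 0) ≡ suc d ℕ.* 1
    eq = trans (cong suc (trans (ℕₚ.+-identityʳ (d ℕ.+ 0)) (ℕₚ.+-identityʳ d))) (sym (ℕₚ.*-identityʳ (suc d)))
  archimedean (mkℚ (+ 0) d _) (*<* (ℤ.+<+ ()))
  archimedean (mkℚ ℤ.-[1+ n ] d _) (*<* ())

  -- The multiplier from `archimedean` may be far larger than 1/g. Minimality gives the upper bound
  -- 1 + g, on which the polynomial size of the threshold rests.
  least-multiple : ∀ {g} → 0ℚ < g → ∀ k → 1ℚ ≤ ι k * g → ∃[ v ] 0 ℕ.< v × 1ℚ ≤ ι v * g × ι v * g ≤ 1ℚ + g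
  least-multiple {g} 0<g zero le = contradiction (≤-trans le (≤-reflexive (*-zeroˡ g))) (<⇒≱ (positive⁻¹ 1ℚ))
  least-multiple {g} 0<g (suc k) le with 1ℚ ≤? ι k * g
  ... | yes le′ = least-multiple 0<g k le′
  ... | no ≰ = suc k , ℕ.s≤s ℕ.z≤n , le ,
    ≤-trans (≤-reflexive (trans (cong (_* g) (ι-+ 1 k)) (trans (*-distribʳ-+ g (ι 1) (ι k))
      (trans (cong (_+ ι k * g) (*-identityˡ g)) (+-comm g (ι k * g)))))) (+-monoˡ-≤ g (<⇒≤ (≰⇒> ≰)))

  invℚ-inverseʳ : ∀ {q} → 0ℚ < q → q * invℚ q ≡ 1ℚ
  invℚ-inverseʳ {q} 0<q with q ≟ 0ℚ
  ... | yes q≡0 = contradiction (sym q≡0) (<⇒≢ 0<q)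
  ... | no q≢0  = *-inverseʳ q {{≢-nonZero q≢0}}

  invℚ-pos : ∀ {q} → 0ℚ < q → 0ℚ < invℚ q
  invℚ-pos {q} 0<q with q ≟ 0ℚ
  ... | yes q≡0 = contradiction (sym q≡0) (<⇒≢ 0<q)
  ... | no q≢0  = positive⁻¹ _ {{1/pos⇒pos q {{positive 0<q}}}}

  -- Q, m and h stand for approximations of c₂ and c₁* and their error; the hypotheses of the
  -- three lemmas are the regimes of C(α, Q/2).
  Bounds : (α Q m η : ℚ) → Set
  Bounds α Q m η = α * (Q - α * α) ≤ ι 2 * (1ℚ - α) * m + η ×
    ι 2 * α * (Q - α * α) - ι 3 * (α * α) * (1ℚ - α) ≤ (1ℚ - α) * m + η

  module Regimes {α i Q m h : ℚ} (0<α : 0ℚ < α) (α<1 : α < 1ℚ) (si≡1 : (1ℚ - α) * i ≡ 1ℚ) (0<h : 0ℚ < h) where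

    private
      0≤α : 0ℚ ≤ α
      0≤α = <⇒≤ 0<α
      0≤h : 0ℚ ≤ h
      0≤h = <⇒≤ 0<h
      0≤s : 0ℚ ≤ 1ℚ - α
      0≤s = ≤⇒0≤- (<⇒≤ α<1)

      scaled : ∀ {y} → y ≤ m + h → 0ℚ ≤ (1ℚ - α) * (m + h - y)
      scaled le = 0≤-* 0≤s (≤⇒0≤- le)

    -- With d = Q/2, the last formula minus the middle one is 3α/(1 - α) · (d - α(1 - α/2)), and the
    -- middle one has the sign of 2d - α². So C is the largest of 0 and both formulas, and both
    -- inequalities of `Bounds` hold in every regime, here and in the next two lemmas. The errors of
    -- size h add up to at most 8h.
    low-bounds : 0ℚ ≤ m + h → Q * ½ ≤ α * α * ½ + h → Bounds α Q m (ι 8 * h)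
    low-bounds value range =
      ≤-by _ (0≤-+ (0≤-+ (0≤-* (0≤ι 2) (scaled value)) (0≤-* (0≤-* (0≤ι 2) 0≤α) (≤⇒0≤- range)))
        (0≤-* (0≤ι 6) 0≤h)) (mid-identity α m h Q) ,
      ≤-by _ (0≤-+ (0≤-+ (0≤-+ (scaled value) (0≤-* (0≤-* (0≤ι 4) 0≤α) (≤⇒0≤- range)))
        (0≤-* (0≤-* (0≤ι 3) (0≤-* 0≤α 0≤α)) 0≤s)) (0≤-* (0≤-+ (0≤ι 4) (0≤-* (0≤ι 3) 0≤s)) 0≤h)) (high-identity α m h Q)
      where
      mid-identity : ∀ α m h Q → ι 2 * (1ℚ - α) * m + ι 8 * h ≡ α * (Q - α * α) +
        (ι 2 * ((1ℚ - α) * (m + h - 0ℚ)) + ι 2 * α * (α * α * ½ + h - Q * ½) + ι 6 * h)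
      mid-identity = solve 4 (λ α m h Q →
        con (ι 2) :* (con 1ℚ :- α) :* m :+ con (ι 8) :* h := α :* (Q :- α :* α) :+
        (con (ι 2) :* ((con 1ℚ :- α) :* (m :+ h :- con 0ℚ)) :+ con (ι 2) :* α :* (α :* α :* con ½ :+ h :- Q :* con ½)
          :+ con (ι 6) :* h)) refl
      high-identity : ∀ α m h Q → (1ℚ - α) * m + ι 8 * h ≡
        ι 2 * α * (Q - α * α) - ι 3 * (α * α) * (1ℚ - α) +
        ((1ℚ - α) * (m + h - 0ℚ) + ι 4 * α * (α * α * ½ + h - Q * ½) + ι 3 * (α * α) * (1ℚ - α)
          + (ι 4 + ι 3 * (1ℚ - α)) * h)
      high-identity = solve 4 (λ α m h Q → let s = con 1ℚ :- α in
        s :* m :+ con (ι 8) :* h :=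
        con (ι 2) :* α :* (Q :- α :* α) :- con (ι 3) :* (α :* α) :* s :+
        (s :* (m :+ h :- con 0ℚ) :+ con (ι 4) :* α :* (α :* α :* con ½ :+ h :- Q :* con ½)
          :+ con (ι 3) :* (α :* α) :* s :+ (con (ι 4) :+ con (ι 3) :* s) :* h)) refl

    private
      unscale : ∀ x → (1ℚ - α) * i * x ≡ x
      unscale x = trans (cong (_* x) si≡1) (*-identityˡ x)

    mid-bounds : α * i * ((ι 2 * (Q * ½) - α * α) * ½) ≤ m + h → Q * ½ ≤ α * (1ℚ - α * ½) + h → Bounds α Q m (ι 8 * h)
    mid-bounds value range =
      ≤-by _ (0≤-+ (0≤-* (0≤ι 2) value′) (0≤-* (0≤-+ (0≤ι 6) (0≤-* (0≤ι 2) 0≤α)) 0≤h)) (mid-identity α m h Q) ,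
      ≤-by _ (0≤-+ (0≤-+ value′ (0≤-* (0≤-* (0≤ι 3) 0≤α) (≤⇒0≤- range)))
        (0≤-* (0≤-+ (0≤ι 5) (0≤-* (0≤ι 2) 0≤s)) 0≤h)) (high-identity α m h Q)
      where
      expand : ∀ α i m h Q → (1ℚ - α) * (m + h - α * i * ((ι 2 * (Q * ½) - α * α) * ½)) ≡
        (1ℚ - α) * (m + h) - (1ℚ - α) * i * (α * (Q - α * α) * ½)
      expand = solve 5 (λ α i m h Q →
        (con 1ℚ :- α) :* (m :+ h :- α :* i :* ((con (ι 2) :* (Q :* con ½) :- α :* α) :* con ½)) :=
        (con 1ℚ :- α) :* (m :+ h) :- (con 1ℚ :- α) :* i :* (α :* (Q :- α :* α) :* con ½)) refl
      value′ : 0ℚ ≤ (1ℚ - α) * (m + h) - α * (Q - α * α) * ½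
      value′ = subst (0ℚ ≤_) (trans (expand α i m h Q) (cong (λ x → (1ℚ - α) * (m + h) - x) (unscale _))) (scaled value)
      mid-identity : ∀ α m h Q → ι 2 * (1ℚ - α) * m + ι 8 * h ≡ α * (Q - α * α) +
        (ι 2 * ((1ℚ - α) * (m + h) - α * (Q - α * α) * ½) + (ι 6 + ι 2 * α) * h)
      mid-identity = solve 4 (λ α m h Q →
        con (ι 2) :* (con 1ℚ :- α) :* m :+ con (ι 8) :* h := α :* (Q :- α :* α) :+
        (con (ι 2) :* ((con 1ℚ :- α) :* (m :+ h) :- α :* (Q :- α :* α) :* con ½)
          :+ (con (ι 6) :+ con (ι 2) :* α) :* h)) refl
      high-identity : ∀ α m h Q → (1ℚ - α) * m + ι 8 * h ≡
        ι 2 * α * (Q - α * α) - ι 3 * (α * α) * (1ℚ - α) +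
        ((1ℚ - α) * (m + h) - α * (Q - α * α) * ½ + ι 3 * α * (α * (1ℚ - α * ½) + h - Q * ½)
          + (ι 5 + ι 2 * (1ℚ - α)) * h)
      high-identity = solve 4 (λ α m h Q → let s = con 1ℚ :- α in
        s :* m :+ con (ι 8) :* h :=
        con (ι 2) :* α :* (Q :- α :* α) :- con (ι 3) :* (α :* α) :* s :+
        (s :* (m :+ h) :- α :* (Q :- α :* α) :* con ½ :+
          con (ι 3) :* α :* (α :* (con 1ℚ :- α :* con ½) :+ h :- Q :* con ½)
          :+ (con (ι 5) :+ con (ι 2) :* s) :* h)) refl

    high-bounds : ι 2 * α * i * (ι 2 * (Q * ½) - α * α) - ι 3 * (α * α) ≤ m + h → α * (1ℚ - α * ½) ≤ Q * ½ →
      Bounds α Q m (ι 8 * h)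
    high-bounds value range =
      ≤-by _ (0≤-+ (0≤-+ (0≤-* (0≤ι 2) value′) (0≤-* (0≤-* (0≤ι 6) 0≤α) (≤⇒0≤- range)))
        (0≤-* (0≤-+ (0≤ι 6) (0≤-* (0≤ι 2) 0≤α)) 0≤h)) (mid-identity α m h Q) ,
      ≤-by _ (0≤-+ value′ (0≤-* (0≤-+ (0≤ι 7) 0≤α) 0≤h)) (high-identity α m h Q)
      where
      expand : ∀ α i m h Q → (1ℚ - α) * (m + h - (ι 2 * α * i * (ι 2 * (Q * ½) - α * α) - ι 3 * (α * α))) ≡
        (1ℚ - α) * (m + h) + ι 3 * (α * α) * (1ℚ - α) - (1ℚ - α) * i * (ι 2 * α * (Q - α * α))
      expand = solve 5 (λ α i m h Q → let s = con 1ℚ :- α in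
        s :* (m :+ h :- (con (ι 2) :* α :* i :* (con (ι 2) :* (Q :* con ½) :- α :* α) :- con (ι 3) :* (α :* α))) :=
        s :* (m :+ h) :+ con (ι 3) :* (α :* α) :* s :- s :* i :* (con (ι 2) :* α :* (Q :- α :* α))) refl
      value′ : 0ℚ ≤ (1ℚ - α) * (m + h) + ι 3 * (α * α) * (1ℚ - α) - ι 2 * α * (Q - α * α)
      value′ = subst (0ℚ ≤_) (trans (expand α i m h Q)
        (cong (λ x → (1ℚ - α) * (m + h) + ι 3 * (α * α) * (1ℚ - α) - x) (unscale _))) (scaled value)
      mid-identity : ∀ α m h Q → ι 2 * (1ℚ - α) * m + ι 8 * h ≡ α * (Q - α * α) +
        (ι 2 * ((1ℚ - α) * (m + h) + ι 3 * (α * α) * (1ℚ - α) - ι 2 * α * (Q - α * α))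
          + ι 6 * α * (Q * ½ - α * (1ℚ - α * ½)) + (ι 6 + ι 2 * α) * h)
      mid-identity = solve 4 (λ α m h Q → let s = con 1ℚ :- α in
        con (ι 2) :* s :* m :+ con (ι 8) :* h := α :* (Q :- α :* α) :+
        (con (ι 2) :* (s :* (m :+ h) :+ con (ι 3) :* (α :* α) :* s :- con (ι 2) :* α :* (Q :- α :* α))
          :+ con (ι 6) :* α :* (Q :* con ½ :- α :* (con 1ℚ :- α :* con ½)) :+ (con (ι 6) :+ con (ι 2) :* α) :* h)) refl
      high-identity : ∀ α m h Q → (1ℚ - α) * m + ι 8 * h ≡
        ι 2 * α * (Q - α * α) - ι 3 * (α * α) * (1ℚ - α) +
        ((1ℚ - α) * (m + h) + ι 3 * (α * α) * (1ℚ - α) - ι 2 * α * (Q - α * α) + (ι 7 + α) * h)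
      high-identity = solve 4 (λ α m h Q → let s = con 1ℚ :- α in
        s :* m :+ con (ι 8) :* h :=
        con (ι 2) :* α :* (Q :- α :* α) :- con (ι 3) :* (α :* α) :* s :+
        (s :* (m :+ h) :+ con (ι 3) :* (α :* α) :* s :- con (ι 2) :* α :* (Q :- α :* α) :+ (con (ι 7) :+ α) :* h)) refl

  -- `c`, `m` and `Q` will be the terms of c₁, c₁* and c₂ at a common index, `A` and `B` two degrees
  -- and `U` the integer u. The limits below no longer mention these terms, so they may change with
  -- η.
  record Approximation (α U A B N η : ℚ) : Set where
    field
      c m Q     : ℚ
      c-lower   : c * N ≤ A + η
      Q-upper   : B ≤ Q * N + η
      gap       : 1ℚ + U * m ≤ U * c
      mid-gap   : α * (Q - α * α) ≤ ι 2 * (1ℚ - α) * m + η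
      high-gap  : ι 2 * α * (Q - α * α) - ι 3 * (α * α) * (1ℚ - α) ≤ (1ℚ - α) * m + η

  module _ {α U A B N : ℚ} (0<α : 0ℚ < α) (α<1 : α < 1ℚ) (0<U : 0ℚ < U) (0≤N : 0ℚ ≤ N)
    (approx : ∀ η → 0ℚ < η → ¬ ¬ Approximation α U A B N η) where

    private
      0≤α : 0ℚ ≤ α
      0≤α = <⇒≤ 0<α
      0≤U : 0ℚ ≤ U
      0≤U = <⇒≤ 0<U
      0≤s : 0ℚ ≤ 1ℚ - α
      0≤s = ≤⇒0≤- (<⇒≤ α<1)
      0<+ : ∀ {p q} → 0ℚ ≤ p → 0ℚ < q → 0ℚ < p + q
      0<+ {p} {q} 0≤p 0<q = subst (_< p + q) (+-identityʳ 0ℚ) (+-mono-≤-< 0≤p 0<q)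

    -- Chains A ≥ cN ≥ (m + 1/U)N with 2(1 - α)m ≥ α(Q - α²) and QN ≥ B, all up to η, after
    -- multiplication by 2(1 - α)U. `high-limit` does the same with the last formula.
    mid-limit : α * U * (B - α * α * N) + ι 2 * (1ℚ - α) * N ≤ ι 2 * (1ℚ - α) * A * U
    mid-limit = limit (0<+ (0≤-+ (0≤-* (0≤-* (0≤ι 2) 0≤s) 0≤U) (0≤-* 0≤N 0≤U)) (0<-* 0<α 0<U))
      λ η 0<η refute → approx η 0<η λ a → refute (bound a)
      where
      identity : ∀ α U A B N η c m Q →
        ι 2 * (1ℚ - α) * A * U + η * (ι 2 * (1ℚ - α) * U + N * U + α * U) ≡
        α * U * (B - α * α * N) + ι 2 * (1ℚ - α) * N +
        (ι 2 * (1ℚ - α) * U * (A + η - c * N) + ι 2 * (1ℚ - α) * N * (U * c - (1ℚ + U * m))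
          + N * U * (ι 2 * (1ℚ - α) * m + η - α * (Q - α * α)) + α * U * (Q * N + η - B))
      identity = solve 9 (λ α U A B N η c m Q → let s = con 1ℚ :- α; two = con (ι 2) in
        two :* s :* A :* U :+ η :* (two :* s :* U :+ N :* U :+ α :* U) :=
        α :* U :* (B :- α :* α :* N) :+ two :* s :* N :+
        (two :* s :* U :* (A :+ η :- c :* N) :+ two :* s :* N :* (U :* c :- (con 1ℚ :+ U :* m))
          :+ N :* U :* (two :* s :* m :+ η :- α :* (Q :- α :* α)) :+ α :* U :* (Q :* N :+ η :- B))) refl
      bound : ∀ {η} → Approximation α U A B N η → α * U * (B - α * α * N) + ι 2 * (1ℚ - α) * N ≤
        ι 2 * (1ℚ - α) * A * U + η * (ι 2 * (1ℚ - α) * U + N * U + α * U)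
      bound {η} a = ≤-by _
        (0≤-+ (0≤-+ (0≤-+ (0≤-* (0≤-* (0≤-* (0≤ι 2) 0≤s) 0≤U) (≤⇒0≤- c-lower))
          (0≤-* (0≤-* (0≤-* (0≤ι 2) 0≤s) 0≤N) (≤⇒0≤- gap)))
          (0≤-* (0≤-* 0≤N 0≤U) (≤⇒0≤- mid-gap)))
          (0≤-* (0≤-* 0≤α 0≤U) (≤⇒0≤- Q-upper)))
        (identity α U A B N η c m Q)
        where open Approximation a

    high-limit : ι 4 * α * U * (B - α * α * N) - ι 6 * (α * α) * (1ℚ - α) * N * U + ι 2 * (1ℚ - α) * N
      ≤ ι 2 * (1ℚ - α) * A * U
    high-limit = limit (0<+ (0≤-+ (0≤-* (0≤-* (0≤ι 2) 0≤s) 0≤U) (0≤-* (0≤-* (0≤ι 2) 0≤N) 0≤U))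
      (0<-* (0<-* (0<ι {4} (ℕ.s≤s ℕ.z≤n)) 0<α) 0<U))
      λ η 0<η refute → approx η 0<η λ a → refute (bound a)
      where
      identity : ∀ α U A B N η c m Q →
        ι 2 * (1ℚ - α) * A * U + η * (ι 2 * (1ℚ - α) * U + ι 2 * N * U + ι 4 * α * U) ≡
        ι 4 * α * U * (B - α * α * N) - ι 6 * (α * α) * (1ℚ - α) * N * U + ι 2 * (1ℚ - α) * N +
        (ι 2 * (1ℚ - α) * U * (A + η - c * N) + ι 2 * (1ℚ - α) * N * (U * c - (1ℚ + U * m))
          + ι 2 * N * U * ((1ℚ - α) * m + η - (ι 2 * α * (Q - α * α) - ι 3 * (α * α) * (1ℚ - α)))
          + ι 4 * α * U * (Q * N + η - B))
      identity = solve 9 (λ α U A B N η c m Q → let s = con 1ℚ :- α; two = con (ι 2); four = con (ι 4) in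
        two :* s :* A :* U :+ η :* (two :* s :* U :+ two :* N :* U :+ four :* α :* U) :=
        four :* α :* U :* (B :- α :* α :* N) :- con (ι 6) :* (α :* α) :* s :* N :* U :+ two :* s :* N :+
        (two :* s :* U :* (A :+ η :- c :* N) :+ two :* s :* N :* (U :* c :- (con 1ℚ :+ U :* m))
          :+ two :* N :* U :* (s :* m :+ η :- (two :* α :* (Q :- α :* α) :- con (ι 3) :* (α :* α) :* s))
          :+ four :* α :* U :* (Q :* N :+ η :- B))) refl
      bound : ∀ {η} → Approximation α U A B N η →
        ι 4 * α * U * (B - α * α * N) - ι 6 * (α * α) * (1ℚ - α) * N * U + ι 2 * (1ℚ - α) * N ≤
        ι 2 * (1ℚ - α) * A * U + η * (ι 2 * (1ℚ - α) * U + ι 2 * N * U + ι 4 * α * U)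
      bound {η} a = ≤-by _
        (0≤-+ (0≤-+ (0≤-+ (0≤-* (0≤-* (0≤-* (0≤ι 2) 0≤s) 0≤U) (≤⇒0≤- c-lower))
          (0≤-* (0≤-* (0≤-* (0≤ι 2) 0≤s) 0≤N) (≤⇒0≤- gap)))
          (0≤-* (0≤-* (0≤-* (0≤ι 2) 0≤N) 0≤U) (≤⇒0≤- high-gap)))
          (0≤-* (0≤-* (0≤-* (0≤ι 4) 0≤α) 0≤U) (≤⇒0≤- Q-upper)))
        (identity α U A B N η c m Q)
        where open Approximation a

  record Fraction (p j : ℕ) : Set where
    field
      α   : ℚ
      0<α : 0ℚ < α
      α<1 : α < 1ℚ
      p↦  : p ↦ α * ι (p ℕ.+ j)
      j↦  : j ↦ (1ℚ - α) * ι (p ℕ.+ j)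

  fraction : ∀ p j → 0 ℕ.< p → 0 ℕ.< j → Fraction p j
  fraction p j 0<p 0<j = record
    { α = α ; 0<α = 0<-* (0<ι 0<p) 0<r
    ; α<1 = subst (_< 1ℚ) (+-identityʳ α) (subst (α + 0ℚ <_) α+s≡1 (+-monoʳ-< α (0<-* (0<ι 0<j) 0<r)))
    ; p↦ = ↦-by (cancel p)
    ; j↦ = ↦-by (trans (cancel j) (cong (_* ι (p ℕ.+ j)) s≡1-α)) }
    where
    0<q : 0ℚ < ι (p ℕ.+ j)
    0<q = 0<ι (ℕₚ.<-≤-trans 0<p (ℕₚ.m≤m+n p j))
    instance
      _ = positive 0<q
      _ = pos⇒nonZero (ι (p ℕ.+ j))
    r = 1/ ι (p ℕ.+ j)
    0<r = positive⁻¹ r {{1/pos⇒pos (ι (p ℕ.+ j))}}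
    α = ι p * r
    cancel : ∀ k → ι k ≡ ι k * r * ι (p ℕ.+ j)
    cancel k = sym (trans (*-assoc (ι k) r _) (trans (cong (ι k *_) (*-inverseˡ (ι (p ℕ.+ j)))) (*-identityʳ (ι k))))
    α+s≡1 : α + ι j * r ≡ 1ℚ
    α+s≡1 = trans (sym (*-distribʳ-+ r (ι p) (ι j))) (trans (cong (_* r) (sym (ι-+ p j))) (*-inverseʳ (ι (p ℕ.+ j))))
    difference : ∀ x y → y ≡ x + y - x
    difference = solve 2 (λ x y → y := x :+ y :- x) refl
    s≡1-α : ι j * r ≡ 1ℚ - α
    s≡1-α = trans (difference α (ι j * r)) (cong (_- α) α+s≡1)

  -- The two limits at α = p/q, multiplied by q³; `Fraction` rewrites p as α q and j as (1 - α) q.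
  dense : ∀ {u N a b} → 0 ℕ.< u →
    (∀ α → 0ℚ < α → α < 1ℚ → ∀ η → 0ℚ < η → ¬ ¬ Approximation α (ι u) (ι a) (ι b) (ι N) η) →
    Dense u N a b
  dense {u} {N} {a} {b} 0<u approx = record { mid = mid ; high = high }
    where
    mid : ∀ p j → 0 ℕ.< p → 0 ℕ.< j → let q = p ℕ.+ j in
      p ℕ.* u ℕ.* (q ℕ.* q) ℕ.* b ℕ.+ 2 ℕ.* j ℕ.* (q ℕ.* q) ℕ.* N
        ℕ.≤ 2 ℕ.* j ℕ.* (q ℕ.* q) ℕ.* a ℕ.* u ℕ.+ u ℕ.* (p ℕ.* p ℕ.* p) ℕ.* N
    mid p j 0<p 0<j = ↦-cancel-≤
      (p↦ ⟨*⟩ ⟪ u ⟫ ⟨*⟩ (⟪ q ⟫ ⟨*⟩ ⟪ q ⟫) ⟨*⟩ ⟪ b ⟫ ⟨+⟩ ⟪ 2 ⟫ ⟨*⟩ j↦ ⟨*⟩ (⟪ q ⟫ ⟨*⟩ ⟪ q ⟫) ⟨*⟩ ⟪ N ⟫)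
      (⟪ 2 ⟫ ⟨*⟩ j↦ ⟨*⟩ (⟪ q ⟫ ⟨*⟩ ⟪ q ⟫) ⟨*⟩ ⟪ a ⟫ ⟨*⟩ ⟪ u ⟫ ⟨+⟩ ⟪ u ⟫ ⟨*⟩ (p↦ ⟨*⟩ p↦ ⟨*⟩ p↦) ⟨*⟩ ⟪ N ⟫)
      (≤-by _ (0≤-* (0≤-* (0≤-* (0≤ι q) (0≤ι q)) (0≤ι q))
        (≤⇒0≤- (mid-limit 0<α α<1 (0<ι 0<u) (0≤ι N) (approx α 0<α α<1))))
        (identity α (ι q) (ι u) (ι a) (ι b) (ι N)))
      where
      q = p ℕ.+ j
      open Fraction (fraction p j 0<p 0<j)
      identity : ∀ α q U A B N →
        ι 2 * ((1ℚ - α) * q) * (q * q) * A * U + U * (α * q * (α * q) * (α * q)) * N ≡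
        α * q * U * (q * q) * B + ι 2 * ((1ℚ - α) * q) * (q * q) * N +
        q * q * q * (ι 2 * (1ℚ - α) * A * U - (α * U * (B - α * α * N) + ι 2 * (1ℚ - α) * N))
      identity = solve 6 (λ α q U A B N → let s = con 1ℚ :- α; two = con (ι 2) in
        two :* (s :* q) :* (q :* q) :* A :* U :+ U :* (α :* q :* (α :* q) :* (α :* q)) :* N :=
        α :* q :* U :* (q :* q) :* B :+ two :* (s :* q) :* (q :* q) :* N :+
        q :* q :* q :* (two :* s :* A :* U :- (α :* U :* (B :- α :* α :* N) :+ two :* s :* N))) refl
    high : ∀ p j → 0 ℕ.< p → 0 ℕ.< j → let q = p ℕ.+ j in
      4 ℕ.* p ℕ.* u ℕ.* (q ℕ.* q) ℕ.* b ℕ.+ 2 ℕ.* j ℕ.* (q ℕ.* q) ℕ.* N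
        ℕ.≤ 2 ℕ.* j ℕ.* (q ℕ.* q) ℕ.* a ℕ.* u ℕ.+ 4 ℕ.* (p ℕ.* p ℕ.* p) ℕ.* N ℕ.* u
        ℕ.+ 6 ℕ.* (p ℕ.* p) ℕ.* j ℕ.* N ℕ.* u
    high p j 0<p 0<j = ↦-cancel-≤
      (⟪ 4 ⟫ ⟨*⟩ p↦ ⟨*⟩ ⟪ u ⟫ ⟨*⟩ (⟪ q ⟫ ⟨*⟩ ⟪ q ⟫) ⟨*⟩ ⟪ b ⟫ ⟨+⟩ ⟪ 2 ⟫ ⟨*⟩ j↦ ⟨*⟩ (⟪ q ⟫ ⟨*⟩ ⟪ q ⟫) ⟨*⟩ ⟪ N ⟫)
      (⟪ 2 ⟫ ⟨*⟩ j↦ ⟨*⟩ (⟪ q ⟫ ⟨*⟩ ⟪ q ⟫) ⟨*⟩ ⟪ a ⟫ ⟨*⟩ ⟪ u ⟫ ⟨+⟩ ⟪ 4 ⟫ ⟨*⟩ (p↦ ⟨*⟩ p↦ ⟨*⟩ p↦) ⟨*⟩ ⟪ N ⟫ ⟨*⟩ ⟪ u ⟫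
        ⟨+⟩ ⟪ 6 ⟫ ⟨*⟩ (p↦ ⟨*⟩ p↦) ⟨*⟩ j↦ ⟨*⟩ ⟪ N ⟫ ⟨*⟩ ⟪ u ⟫)
      (≤-by _ (0≤-* (0≤-* (0≤-* (0≤ι q) (0≤ι q)) (0≤ι q))
        (≤⇒0≤- (high-limit 0<α α<1 (0<ι 0<u) (0≤ι N) (approx α 0<α α<1))))
        (identity α (ι q) (ι u) (ι a) (ι b) (ι N)))
      where
      q = p ℕ.+ j
      open Fraction (fraction p j 0<p 0<j)
      identity : ∀ α q U A B N →
        ι 2 * ((1ℚ - α) * q) * (q * q) * A * U + ι 4 * (α * q * (α * q) * (α * q)) * N * U
          + ι 6 * (α * q * (α * q)) * ((1ℚ - α) * q) * N * U ≡
        ι 4 * (α * q) * U * (q * q) * B + ι 2 * ((1ℚ - α) * q) * (q * q) * N +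
        q * q * q * (ι 2 * (1ℚ - α) * A * U -
          (ι 4 * α * U * (B - α * α * N) - ι 6 * (α * α) * (1ℚ - α) * N * U + ι 2 * (1ℚ - α) * N))
      identity = solve 6 (λ α q U A B N → let s = con 1ℚ :- α; two = con (ι 2); four = con (ι 4) in
        two :* (s :* q) :* (q :* q) :* A :* U :+ four :* (α :* q :* (α :* q) :* (α :* q)) :* N :* U
          :+ con (ι 6) :* (α :* q :* (α :* q)) :* (s :* q) :* N :* U :=
        four :* (α :* q) :* U :* (q :* q) :* B :+ two :* (s :* q) :* (q :* q) :* N :+
        q :* q :* q :* (two :* s :* A :* U :-
          (four :* α :* U :* (B :- α :* α :* N) :- con (ι 6) :* (α :* α) :* s :* N :* U :+ two :* s :* N))) refl

  -- `g` is one approximation of the gap c₁ - c₁*, `x` a later one and `X` its inverse. Taking u =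
  -- 2v with v least such that vg ≥ 1 gives ux ≥ vg ≥ 1 when x ≥ g/2, and u ≤ 2 + 2/g ≤ 2 + 3/x when
  -- x ≤ 3g/2.
  record Scale (g : ℚ) : Set where
    field
      u     : ℕ
      2≤u   : 2 ℕ.≤ u
      large : ∀ {x} → ½ * g ≤ x → 1ℚ ≤ ι u * x
      small : ∀ {x X} → ½ * g ≤ x → x ≤ (1ℚ + ½) * g → 0ℚ ≤ X → x * X ≡ 1ℚ → ι u ≤ ι 6 * (1ℚ + X)

  scale : ∀ {g} → 0ℚ < g → Scale g
  scale {g} 0<g with archimedean g 0<g
  ... | k , le with least-multiple 0<g k le
  ... | v , 0<v , 1≤vg , vg≤1+g = record
    { u = 2 ℕ.* v ; 2≤u = ℕₚ.*-monoʳ-≤ 2 0<v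
    ; large = λ {x} half≤x → ≤-trans 1≤vg (≤-by _ (0≤-* (0≤-* (0≤ι 2) (0≤ι v)) (≤⇒0≤- half≤x))
        (trans (cong (_* x) (ι-* 2 v)) (large-identity (ι v) g x)))
    ; small = λ {x} {X} half≤x x≤ 0≤X xX≡1 → subst (_≤ ι 6 * (1ℚ + X)) (trans (*-identityʳ _) (sym (ι-* 2 v)))
        (subst (λ t → ι 2 * ι v * t ≤ ι 6 * (t + X)) xX≡1 (≤-by _
          (0≤-+ (0≤-+ (0≤-+ (0≤-* (0≤-* (0≤-* (0≤ι 2) (0≤ι v)) 0≤X) (≤⇒0≤- x≤))
            (0≤-* (0≤-* (0≤ι 3) 0≤X) (≤⇒0≤- vg≤1+g)))
            (0≤-* (0≤-* (0≤ι 6) 0≤X) (≤⇒0≤- half≤x))) (0≤-* (0≤ι 3) 0≤X))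
          (small-identity (ι v) g x X))) }
    where
    large-identity : ∀ V g x → ι 2 * V * x ≡ V * g + ι 2 * V * (x - ½ * g)
    large-identity = solve 3 (λ V g x → con (ι 2) :* V :* x := V :* g :+ con (ι 2) :* V :* (x :- con ½ :* g)) refl
    small-identity : ∀ V g x X → ι 6 * (x * X + X) ≡ ι 2 * V * (x * X) +
      (ι 2 * V * X * ((1ℚ + ½) * g - x) + ι 3 * X * (1ℚ + g - V * g) + ι 6 * X * (x - ½ * g) + ι 3 * X)
    small-identity = solve 4 (λ V g x X → let three = con (ι 3); two = con (ι 2); six = con (ι 6) in
      six :* (x :* X :+ X) := two :* V :* (x :* X) :+
      (two :* V :* X :* ((con 1ℚ :+ con ½) :* g :- x) :+ three :* X :* (con 1ℚ :+ g :- V :* g)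
        :+ six :* X :* (x :- con ½ :* g) :+ three :* X)) refl

open import Defs
open import Data.List using (List; []; _∷_; length)
open import Data.Nat as ℕ using (ℕ; suc)
open import Data.Nat.Combinatorics using (_C_)
open import Data.Nat.Divisibility using (_∣_; divides)
import Data.Nat.Properties as ℕₚ
open import Data.Nat.Tactic.RingSolver using (solve-∀)
open import Data.Product using (_×_; _,_; proj₁; proj₂; Σ-syntax; ∃-syntax)
open import Data.Rational as ℚ using (ℚ; 0ℚ; 1ℚ; ½)
import Data.Rational.Properties as ℚₚ
open import Data.Rational.Solver using (module +-*-Solver)
open import Data.Sum.Base using (_⊎_; inj₁; inj₂)
open import Data.Vec using (sum; lookup)
open import Function.Bundles using (_⇔_; mk⇔)
open import Relation.Binary.PropositionalEquality using (_≡_; refl; sym; trans; cong; subst)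
open import Relation.Nullary using (¬_; yes; no; contradiction)
open import Relation.Nullary.Decidable using (¬¬-excluded-middle)
open import Algebra.Properties.Semiring.Sum ℕₚ.+-*-semiring using (sum-cong-≗) renaming (sum to ∑)
open +-*-Solver using (solve; con; _:=_; _:+_; _:*_; _:-_)
open Combinatorics
  using (deg; deg≡length; Simple3; Allocation; realize; handshake; sum≡∑; extremes;
    ∑-≥; ∑-≤; nC2; Dense; module Counting)
open Approximations

-- Inequalities that hold from some index of the Cauchy sequences on

Eventually : (ℕ → Set) → Set
Eventually P = ∃[ T ] ∀ n → T ℕ.≤ n → P n

infixr 2 _&_
_&_ : ∀ {P Q} → Eventually P → Eventually Q → Eventually (λ n → P n × Q n)
(S , p) & (T , q) = S ℕ.⊔ T , λ n le →
  p n (ℕₚ.m⊔n≤o⇒m≤o S T le) , q n (ℕₚ.m⊔n≤o⇒n≤o S T le)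

eventually-map : ∀ {P Q} → (∀ n → P n → Q n) → Eventually P → Eventually Q
eventually-map f (T , p) = T , λ n le → f n (p n le)

witness : ∀ {P} → Eventually P → ∃[ n ] P n
witness (T , p) = T , p T ℕₚ.≤-refl

p≤∣p∣ : ∀ p → p ℚ.≤ ℚ.∣ p ∣
p≤∣p∣ p with 0ℚ ℚ.≤? p
... | yes 0≤p = ℚₚ.≤-reflexive (sym (ℚₚ.0≤p⇒∣p∣≡p 0≤p))
... | no 0≰p  = ℚₚ.≤-trans (ℚₚ.<⇒≤ (ℚₚ.≰⇒> 0≰p)) (ℚₚ.0≤∣p∣ p)

∣∣<⇒≤ : ∀ {p q} → ℚ.∣ p ∣ ℚ.< q → p ℚ.≤ q
∣∣<⇒≤ {p} lt = ℚₚ.≤-trans (p≤∣p∣ p) (ℚₚ.<⇒≤ lt)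

0<½* : ∀ {ε} → 0ℚ ℚ.< ε → 0ℚ ℚ.< ½ ℚ.* ε
0<½* = 0<-* (ℚₚ.positive⁻¹ ½)

-- The negative order on ℝ still bounds the representing sequences, up to any η.
≤⇒eventually : ∀ x y → x ≤ y → ∀ η → 0ℚ ℚ.< η → Eventually λ n → seq x n ℚ.≤ seq y n ℚ.+ η
≤⇒eventually x y x≤y η 0<η = from-index (cauchy (x - y) ζ 0<ζ)
  where
  ζ : ℚ
  ζ = ½ ℚ.* (½ ℚ.* η)
  0<ζ : 0ℚ ℚ.< ζ
  0<ζ = 0<½* (0<½* 0<η)
  exceeds : ∀ p q z η → p ≡ q ℚ.+ ½ ℚ.* (½ ℚ.* η) ℚ.+
    (½ ℚ.* (½ ℚ.* η) ℚ.- (z ℚ.- (p ℚ.- q)) ℚ.+ (z ℚ.- ½ ℚ.* η))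
  exceeds = solve 4 (λ p q z η → p := q :+ con ½ :* (con ½ :* η) :+
    (con ½ :* (con ½ :* η) :- (z :- (p :- q)) :+ (z :- con ½ :* η))) refl
  bounded-by : ∀ p q z η → q ℚ.+ η ≡ p ℚ.+
    (½ ℚ.* (½ ℚ.* η) ℚ.- (p ℚ.- q ℚ.- z) ℚ.+ (½ ℚ.* η ℚ.- z) ℚ.+ ½ ℚ.* (½ ℚ.* η))
  bounded-by = solve 4 (λ p q z η → q :+ η := p :+
    (con ½ :* (con ½ :* η) :- (p :- q :- z) :+ (con ½ :* η :- z) :+ con ½ :* (con ½ :* η))) refl
  from-index : (∃[ T ] ∀ m n → T ℕ.≤ m → T ℕ.≤ n → ℚ.∣ seq (x - y) m ℚ.- seq (x - y) n ∣ ℚ.< ζ) →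
    Eventually λ n → seq x n ℚ.≤ seq y n ℚ.+ η
  from-index (T , close) = compare (ℚₚ.≤-total (½ ℚ.* η) (seq (x - y) T))
    where
    compare : ½ ℚ.* η ℚ.≤ seq (x - y) T ⊎ seq (x - y) T ℚ.≤ ½ ℚ.* η →
      Eventually λ n → seq x n ℚ.≤ seq y n ℚ.+ η
    compare (inj₁ far) = contradiction (ζ , 0<ζ , T , λ n T≤n →
      ≤-by _ (0≤-+ (≤⇒0≤- (∣∣<⇒≤ (close T n ℕₚ.≤-refl T≤n))) (≤⇒0≤- far))
        (exceeds (seq x n) (seq y n) (seq (x - y) T) η)) x≤y
    compare (inj₂ near) = T , λ n T≤n →
      ≤-by _ (0≤-+ (0≤-+ (≤⇒0≤- (∣∣<⇒≤ (close n T T≤n ℕₚ.≤-refl))) (≤⇒0≤- near)) (ℚₚ.<⇒≤ 0<ζ))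
        (bounded-by (seq x n) (seq y n) (seq (x - y) T) η)

≃-refl : ∀ x → x ≃ x
≃-refl x ε 0<ε = 0 , λ n _ → subst (λ r → ℚ.∣ r ∣ ℚ.< ε) (sym (ℚₚ.+-inverseʳ (seq x n))) 0<ε

fromℚ-< : ∀ {p q} → p ℚ.< q → fromℚ p < fromℚ q
fromℚ-< {p} {q} p<q = q ℚ.- p , <⇒0<- p<q , 0 , λ _ _ → ℚₚ.≤-reflexive (identity p q)
  where
  identity : ∀ p q → p ℚ.+ (q ℚ.- p) ≡ q
  identity = solve 2 (λ p q → p :+ (q :- p) := q) refl

module _ {c₂ c₁* : ℝ} (is-max : Is-c₁* c₂ c₁*) {α : ℚ} (0<α : 0ℚ ℚ.< α) (α<1 : α ℚ.< 1ℚ)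
  {h : ℚ} (0<h : 0ℚ ℚ.< h) where

  private
    a d low-end high-end : ℝ
    a = fromℚ α
    d = c₂ * ½ℝ
    low-end  = a * a * ½ℝ
    high-end = a * (1ℝ - a * ½ℝ)
    a<1 : a < 1ℝ
    a<1 = fromℚ-< α<1

    low-end≤high-end : α ℚ.* α ℚ.* ½ ℚ.≤ α ℚ.* (1ℚ ℚ.- α ℚ.* ½)
    low-end≤high-end = ≤-by _ (0≤-* (ℚₚ.<⇒≤ 0<α) (≤⇒0≤- (ℚₚ.<⇒≤ α<1))) (identity α)
      where
      identity : ∀ α → α ℚ.* (1ℚ ℚ.- α ℚ.* ½) ≡ α ℚ.* α ℚ.* ½ ℚ.+ α ℚ.* (1ℚ ℚ.- α)
      identity = solve 1 (λ α → α :* (con 1ℚ :- α :* con ½) := α :* α :* con ½ :+ α :* (con 1ℚ :- α)) refl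

    -- Makes the `high` clause of `IsC` vacuous in the low regime.
    beyond-low : high-end < d → low-end < d
    beyond-low (ε , 0<ε , T , p) = ε , 0<ε , T , λ n le →
      ℚₚ.≤-trans (ℚₚ.+-monoˡ-≤ ε low-end≤high-end) (p n le)

    inverse : (1ℚ ℚ.- α) ℚ.* invℚ (1ℚ ℚ.- α) ≡ 1ℚ
    inverse = invℚ-inverseʳ (<⇒0<- α<1)

    mid-value high-value : ℝ
    mid-value  = a /[1- a ][ a<1 ] * ((2ℝ * d - a * a) * ½ℝ)
    high-value = (2ℝ * a) /[1- a ][ a<1 ] * (2ℝ * d - a * a) - 3ℝ * (a * a)

    below-max : ∀ y → IsC a a<1 d y → Eventually λ n → seq y n ℚ.≤ seq c₁* n ℚ.+ h
    below-max y is-C = ≤⇒eventually y c₁*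
      (Is-c₁*.upperBound is-max a (fromℚ-< 0<α) a<1 y is-C) h 0<h

  -- The regime of `d` is undecidable, hence the double negation. In each case the formula of that
  -- regime satisfies its own clause of `IsC` by reflexivity and the others vacuously, so it is
  -- bounded by c₁*.
  regime-bounds : ¬ ¬ Eventually λ n → Bounds α (seq c₂ n) (seq c₁* n) (ι 8 ℚ.* h)
  regime-bounds refute = ¬¬-excluded-middle {A = low-end < d} λ where
    (no low) → refute (eventually-map
      (λ n (value , range) → Regimes.low-bounds {Q = seq c₂ n} {m = seq c₁* n} 0<α α<1 inverse 0<h value range)
      (below-max 0ℝ (record { low = λ _ → ≃-refl 0ℝ ; mid = λ above _ → contradiction above low
          ; high = λ above → contradiction (beyond-low above) low })
        & ≤⇒eventually d low-end low h 0<h))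
    (yes above-low) → ¬¬-excluded-middle {A = high-end < d} λ where
      (no mid) → refute (eventually-map
        (λ n (value , range) → Regimes.mid-bounds {Q = seq c₂ n} {m = seq c₁* n} 0<α α<1 inverse 0<h value range)
        (below-max mid-value (record { low = λ low → contradiction above-low low ; mid = λ _ _ → ≃-refl mid-value
            ; high = λ above → contradiction above mid })
          & ≤⇒eventually d high-end mid h 0<h))
      (yes above-mid@(ε , 0<ε , T , range)) → refute (eventually-map
        (λ n (value , range) → Regimes.high-bounds {Q = seq c₂ n} {m = seq c₁* n} 0<α α<1 inverse 0<h value range)
        (below-max high-value (record { low = λ low → contradiction above-low low
            ; mid = λ _ mid → contradiction above-mid mid ; high = λ _ → ≃-refl high-value })
          & (T , λ n le → ℚₚ.≤-trans (≤-by ε (ℚₚ.<⇒≤ 0<ε) refl) (range n le))))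

-- The integer u obtained from the gap c₁ - c₁*

module Gap {c₁ c₁* : ℝ} (c₁*<c₁ : c₁* < c₁) where

  private
    x : ℕ → ℚ
    x = seq (c₁ - c₁*)
    ε = proj₁ c₁*<c₁
    0<ε = proj₁ (proj₂ c₁*<c₁)
    T₀ = proj₁ (proj₂ (proj₂ c₁*<c₁))

    ε≤x : ∀ n → T₀ ℕ.≤ n → ε ℚ.≤ x n
    ε≤x n le = ≤-by _ (≤⇒0≤- (proj₂ (proj₂ (proj₂ c₁*<c₁)) n le)) (identity (seq c₁ n) (seq c₁* n) ε)
      where
      identity : ∀ c m ε → c ℚ.- m ≡ ε ℚ.+ (c ℚ.- (m ℚ.+ ε))
      identity = solve 3 (λ c m ε → c :- m := ε :+ (c :- (m :+ ε))) refl

    settled = cauchy (c₁ - c₁*) (½ ℚ.* ε) (0<½* 0<ε)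
    T = T₀ ℕ.⊔ proj₁ settled
    -- One term of c₁ - c₁* determines u: all later terms are within ε/2 ≤ g/2 of it.
    g = x T

    ε≤g : ε ℚ.≤ g
    ε≤g = ε≤x T (ℕₚ.m≤m⊔n T₀ _)

    0<g : 0ℚ ℚ.< g
    0<g = ℚₚ.<-≤-trans 0<ε ε≤g

    near : ∀ n → T ℕ.≤ n → ½ ℚ.* g ℚ.≤ x n × x n ℚ.≤ (1ℚ ℚ.+ ½) ℚ.* g
    near n le =
      ≤-by _ (0≤-+ (≤⇒0≤- (∣∣<⇒≤ (proj₂ settled T n T≥ n≥))) slack) (lower g (x n) ε) ,
      ≤-by _ (0≤-+ (≤⇒0≤- (∣∣<⇒≤ (proj₂ settled n T n≥ T≥))) slack) (upper g (x n) ε)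
      where
      T≥ = ℕₚ.m≤n⊔m T₀ (proj₁ settled)
      n≥ = ℕₚ.≤-trans T≥ le
      slack : 0ℚ ℚ.≤ ½ ℚ.* (g ℚ.- ε)
      slack = 0≤-* (ℚₚ.<⇒≤ (ℚₚ.positive⁻¹ ½)) (≤⇒0≤- ε≤g)
      lower : ∀ g x ε → x ≡ ½ ℚ.* g ℚ.+ (½ ℚ.* ε ℚ.- (g ℚ.- x) ℚ.+ ½ ℚ.* (g ℚ.- ε))
      lower = solve 3 (λ g x ε → x := con ½ :* g :+ (con ½ :* ε :- (g :- x) :+ con ½ :* (g :- ε))) refl
      upper : ∀ g x ε → (1ℚ ℚ.+ ½) ℚ.* g ≡ x ℚ.+ (½ ℚ.* ε ℚ.- (x ℚ.- g) ℚ.+ ½ ℚ.* (g ℚ.- ε))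
      upper = solve 3 (λ g x ε → (con 1ℚ :+ con ½) :* g := x :+ (con ½ :* ε :- (x :- g) :+ con ½ :* (g :- ε))) refl

    chosen : Scale g
    chosen = scale 0<g

  open Scale chosen public using (u; 2≤u)

  gap-large : Eventually λ n → 1ℚ ℚ.+ ι u ℚ.* seq c₁* n ℚ.≤ ι u ℚ.* seq c₁ n
  gap-large = T , λ n le → ≤-by _ (≤⇒0≤- (Scale.large chosen (proj₁ (near n le)))) (identity (ι u) (seq c₁ n) (seq c₁* n))
    where
    identity : ∀ u c m → u ℚ.* c ≡ 1ℚ ℚ.+ u ℚ.* m ℚ.+ (u ℚ.* (c ℚ.- m) ℚ.- 1ℚ)
    identity = solve 3 (λ u c m → u :* c := con 1ℚ :+ u :* m :+ (u :* (c :- m) :- con 1ℚ)) refl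

  scale-small : Eventually λ n → 0ℚ ℚ.≤ invℚ (x n) × ι u ℚ.≤ ι 6 ℚ.* (1ℚ ℚ.+ invℚ (x n))
  scale-small = T , λ n le →
    let 0<x = ℚₚ.<-≤-trans 0<ε (ε≤x n (ℕₚ.≤-trans (ℕₚ.m≤m⊔n T₀ _) le))
        0≤X = ℚₚ.<⇒≤ (invℚ-pos 0<x)
    in 0≤X , Scale.small chosen (proj₁ (near n le)) (proj₂ (near n le)) 0≤X (invℚ-inverseʳ 0<x)

-- 72576 = 336 · 6³, since u ≤ 6 (1 + X).
cubic : ℚ → ℚ
cubic X = ι 72576 ℚ.* (ι 1 ℚ.+ X ℚ.* (ι 3 ℚ.+ X ℚ.* (ι 3 ℚ.+ X ℚ.* (ι 1 ℚ.+ X ℚ.* 0ℚ))))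

-- For V = 6(1 + X), `cubic X` is 336V³, and V³ - U³ has the factor V - U.
cube-bound : ∀ u {X} → 0ℚ ℚ.≤ X → ι u ℚ.≤ ι 6 ℚ.* (1ℚ ℚ.+ X) → ι (336 ℕ.* (u ℕ.* u ℕ.* u)) ℚ.≤ cubic X
cube-bound u {X} 0≤X U≤V = subst (ℚ._≤ cubic X) (sym image-of-cube) (≤-by _
  (0≤-* (0≤-* (0≤ι 336) (≤⇒0≤- U≤V)) (0≤-+ (0≤-+ (0≤-* 0≤V 0≤V) (0≤-* 0≤V (0≤ι u))) (0≤-* (0≤ι u) (0≤ι u))))
  (identity (ι u) X))
  where
  image-of-cube : ι (336 ℕ.* (u ℕ.* u ℕ.* u)) ≡ ι 336 ℚ.* (ι u ℚ.* ι u ℚ.* ι u)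
  image-of-cube = image (⟪ 336 ⟫ ⟨*⟩ (⟪ u ⟫ ⟨*⟩ ⟪ u ⟫ ⟨*⟩ ⟪ u ⟫))
  0≤V : 0ℚ ℚ.≤ ι 6 ℚ.* (1ℚ ℚ.+ X)
  0≤V = ℚₚ.≤-trans (0≤ι u) U≤V
  identity : ∀ U X → let V = ι 6 ℚ.* (1ℚ ℚ.+ X) in cubic X ≡
    ι 336 ℚ.* (U ℚ.* U ℚ.* U) ℚ.+ ι 336 ℚ.* (V ℚ.- U) ℚ.* (V ℚ.* V ℚ.+ V ℚ.* U ℚ.+ U ℚ.* U)
  identity = solve 2 (λ U X → let V = con (ι 6) :* (con 1ℚ :+ X) in
    con (ι 72576) :* (con (ι 1) :+ X :* (con (ι 3) :+ X :* (con (ι 3) :+ X :* (con (ι 1) :+ X :* con 0ℚ)))) :=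
    con (ι 336) :* (U :* U :* U) :+ con (ι 336) :* (V :- U) :* (V :* V :+ V :* U :+ U :* U)) refl

graphic⇒3∣sum : ∀ {n} (D : DegreeSequence n) → Graphic D → 3 ∣ sum D
graphic⇒3∣sum {n} D (H , H-realizes) = divides (length edges)
  (trans (sum≡∑ D) (trans (sum-cong-≗ {n} {lookup D} {deg edges} λ v → trans (sym (H-realizes v)) (deg≡length edges v))
    (handshake edges uniform)))
  where
  open 3UniformHypergraph H

-- The threshold, its polynomial bound and the realization of D

module _ {c₁ c₂ c₁* : ℝ} (is-max : Is-c₁* c₂ c₁*) (c₁*<c₁ : c₁* < c₁) where
  open Gap {c₁} {c₁*} c₁*<c₁

  threshold : ℕ
  threshold = 336 ℕ.* (u ℕ.* u ℕ.* u)

  -- The order is a negated strict one, so an excess by ε from some index on has to be refuted; a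
  -- single index at which `scale-small` holds as well is enough. `cubic` spells out the terms of
  -- `evalPoly` literally, down to the final product with 0.
  threshold-bound : fromℕ threshold ≤
    fromℕ 72576 * evalPoly (fromℕ 1 ∷ fromℕ 3 ∷ fromℕ 3 ∷ fromℕ 1 ∷ []) ((c₁ - c₁*) ⁻¹[ x<y⇒0<y-x {c₁*} {c₁} c₁*<c₁ ])
  threshold-bound (ε , 0<ε , T , exceeds) = refute (witness ((T , exceeds) & scale-small))
    where
    X : ℕ → ℚ
    X n = invℚ (seq (c₁ - c₁*) n)
    refute : ¬ (∃[ n ] cubic (X n) ℚ.+ ε ℚ.≤ ι threshold × 0ℚ ℚ.≤ X n × ι u ℚ.≤ ι 6 ℚ.* (1ℚ ℚ.+ X n))
    refute (n , exceeds , 0≤X , U≤) = <⇒≱ (ℚₚ.+-monoʳ-< (cubic (X n)) 0<ε)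
      (ℚₚ.≤-trans exceeds (ℚₚ.≤-trans (cube-bound u 0≤X U≤) (ℚₚ.≤-reflexive (sym (ℚₚ.+-identityʳ (cubic (X n)))))))

  -- Any two entries qualify, because each one obeys both bounds; `graphic` takes the least and the
  -- largest.
  dense-degrees : ∀ {n} (D : DegreeSequence n) → DegreesBetween c₁ c₂ D → ∀ i j →
    Dense u ((n ℕ.∸ 1) C 2) (lookup D i) (lookup D j)
  dense-degrees {n} D between i j = dense (ℕₚ.<-≤-trans (ℕ.s≤s ℕ.z≤n) 2≤u) approx
    where
    N = (n ℕ.∸ 1) C 2
    approx : ∀ α → 0ℚ ℚ.< α → α ℚ.< 1ℚ → ∀ η → 0ℚ ℚ.< η →
      ¬ ¬ Approximation α (ι u) (ι (lookup D i)) (ι (lookup D j)) (ι N) η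
    approx α 0<α α<1 η 0<η refute = regimes λ regime →
      refute (assemble (witness (regime & gap-large
        & ≤⇒eventually (c₁ * fromℕ N) (fromℕ (lookup D i)) (proj₁ (between i)) η 0<η
        & ≤⇒eventually (fromℕ (lookup D j)) (c₂ * fromℕ N) (proj₂ (between j)) η 0<η)))
      where
      -- Compensates the factor 8 lost in `regime-bounds`.
      ⅛ : ℚ
      ⅛ = ½ ℚ.* (½ ℚ.* ½)
      regimes : ¬ ¬ Eventually λ n → Bounds α (seq c₂ n) (seq c₁* n) η
      regimes = subst (λ e → ¬ ¬ Eventually λ n → Bounds α (seq c₂ n) (seq c₁* n) e)
        (trans (sym (ℚₚ.*-assoc (ι 8) ⅛ η)) (ℚₚ.*-identityˡ η))
        (regime-bounds is-max 0<α α<1 {⅛ ℚ.* η} (0<-* (ℚₚ.positive⁻¹ ⅛) 0<η))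
      assemble : ∃[ n ] Bounds α (seq c₂ n) (seq c₁* n) η
          × 1ℚ ℚ.+ ι u ℚ.* seq c₁* n ℚ.≤ ι u ℚ.* seq c₁ n
          × seq c₁ n ℚ.* ι N ℚ.≤ ι (lookup D i) ℚ.+ η × ι (lookup D j) ℚ.≤ seq c₂ n ℚ.* ι N ℚ.+ η →
        Approximation α (ι u) (ι (lookup D i)) (ι (lookup D j)) (ι N) η
      assemble (n , (mid , high) , gap , lower , upper) = record
        { c = seq c₁ n ; m = seq c₁* n ; Q = seq c₂ n
        ; c-lower = lower ; Q-upper = upper ; gap = gap ; mid-gap = mid ; high-gap = high }

  0<threshold : 0 ℕ.< threshold
  0<threshold = ℕₚ.*-mono-≤ {1} {336} (ℕ.s≤s ℕ.z≤n) (ℕₚ.*-mono-≤ (ℕₚ.*-mono-≤ 0<u 0<u) 0<u)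
    where
    0<u : 0 ℕ.< u
    0<u = ℕₚ.<-≤-trans (ℕ.s≤s ℕ.z≤n) 2≤u

  graphic : ∀ n → threshold ℕ.≤ n → (D : DegreeSequence n) → DegreesBetween c₁ c₂ D → 3 ∣ sum D → Graphic D
  graphic n n-large D between (divides M sum≡) = from-extremes (extremes 0<n (lookup D))
    where
    0<n : 0 ℕ.< n
    0<n = ℕₚ.<-≤-trans 0<threshold n-large
    total : ∑ (lookup D) ≡ M ℕ.* 3
    total = trans (sym (sum≡∑ D)) sum≡
    N≡ : ∀ n → 0 ℕ.< n → 2 ℕ.* ((n ℕ.∸ 1) C 2) ℕ.+ 3 ℕ.* n ≡ n ℕ.* n ℕ.+ 2
    N≡ (suc m) _ = trans (split (m C 2) m) (trans (cong (ℕ._+ (2 ℕ.* m ℕ.+ 3)) (nC2 m)) (square m))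
      where
      split : ∀ c m → 2 ℕ.* c ℕ.+ 3 ℕ.* suc m ≡ (2 ℕ.* c ℕ.+ m) ℕ.+ (2 ℕ.* m ℕ.+ 3)
      split = solve-∀
      square : ∀ m → m ℕ.* m ℕ.+ (2 ℕ.* m ℕ.+ 3) ≡ suc m ℕ.* suc m ℕ.+ 2
      square = solve-∀
    from-edges : ∃[ es ] Simple3 es × (∀ v → deg es v ≡ lookup D v) → Graphic D
    from-edges (es , (unique , uniform) , degrees) =
      record { edges = es ; unique = unique ; uniform = uniform } ,
      λ v → trans (deg≡length es v) (degrees v)
    from-extremes : (∃[ i ] ∃[ j ] (∀ v → lookup D i ℕ.≤ lookup D v) × (∀ v → lookup D v ℕ.≤ lookup D j)) → Graphic D
    from-extremes (i , j , least , greatest) = from-edges (realize (lookup D) least greatest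
      (subst (Allocation n (lookup D i) (lookup D j)) (sym total)
        (Counting.allocate {n} {u} {(n ℕ.∸ 1) C 2} {lookup D i} {lookup D j} {M} 2≤u n-large
          (N≡ n 0<n) (least j) (dense-degrees D between i j)
          (subst (n ℕ.* lookup D i ℕ.≤_) total (∑-≥ (lookup D) least))
          (subst (ℕ._≤ n ℕ.* lookup D j) total (∑-≤ (lookup D) greatest)))))

theorem3p14 : Σ[ K ∈ ℝ ] Σ[ poly ∈ List ℝ ]
    (∀ (c₁ c₂ c₁* : ℝ) →
    0ℝ < c₁ → c₁ ≤ c₂ → c₂ < 1ℝ →
    Is-c₁* c₂ c₁* → (c₁*<c₁ : c₁* < c₁) →
    Σ[ n₀ ∈ ℕ ]
    (fromℕ n₀ ≤ K * evalPoly poly ((c₁ - c₁*) ⁻¹[ x<y⇒0<y-x {c₁*} {c₁} c₁*<c₁ ])) ×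
    (∀ n → n₀ ℕ.≤ n → (D : DegreeSequence n) →
    DegreesBetween c₁ c₂ D → (Graphic D ⇔ (3 ∣ sum D))) ×
    (∀ n → n₀ ℕ.≤ n → (D : DegreeSequence n) →
    𝒟 c₁ c₂ D → Graphic D))
theorem3p14 = fromℕ 72576 , fromℕ 1 ∷ fromℕ 3 ∷ fromℕ 3 ∷ fromℕ 1 ∷ [] , λ c₁ c₂ c₁* _ _ _ is-max c₁*<c₁ →
  threshold {c₁} {c₂} {c₁*} is-max c₁*<c₁ , threshold-bound {c₁} {c₂} {c₁*} is-max c₁*<c₁ ,
  (λ n n-large D between →
    mk⇔ (graphic⇒3∣sum D) (graphic {c₁} {c₂} {c₁*} is-max c₁*<c₁ n n-large D between)) ,
  (λ n n-large D (3∣sum , between) → graphic {c₁} {c₂} {c₁*} is-max c₁*<c₁ n n-large D between 3∣sum)
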